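{- Assume Selberg's conjectures (A), (B), (C) stated in the context. Let $F\in\mathcal{S}$ and suppose $$F=F_1^{e_1}F_2^{e_2}\cdots F_k^{e_k}$$ where $F_1,\dots,F_k$ are distinct primitive elements of $\mathcal{S}$ and $e_1,\dots,e_k$ are positive integers. Then $$n_F=e_1^2+e_2^2+\cdots+e_k^2.$$
   Context: Write $\sigma=\Re s$, and for a function $\Phi$ put $\overline{\Phi}(s)=\overline{\Phi(\overline{s})}$. The Selberg class $\mathcal{S}$ is the set of Dirichlet series $F(s)=\sum_{n=1}^{\infty} a_n n^{ -s}$ satisfying: (1) Analyticity: $(s-1)^mF(s)$ is (continues to) an entire function of finite order for some non-negative integer $m$. (2) Ramanujan hypothesis: $a_n\ll_\epsilon n^{\epsilon}$ for any fixed $\epsilon>0$. (3) Functional equation: there is a function $\gamma_F(s)=\epsilon Q^s\prod_{i=1}^{k}\Gamma(w_is+\mu_i)$ with $|\epsilon|=1$, $Q>0$, $w_i>0$, $\Re\mu_i\ge 0$ (the product of gamma functions may be empty) such that $\Phi(s)=\gamma_F(s)F(s)$ satisfies $\Phi(s)=\overline{\Phi}(1-s)$. (4) Euler product: $a_1=1$ and $\log F(s)=\sum_{n=1}^{\infty} b_n n^{ -s}$ (for $\sigma>1$), where $b_n=0$ unless $n$ is a positive power of a prime, and $b_n\ll n^{\theta}$ for some $\theta<1/2$. $F\in\mathcal{S}$, $F\ne 1$, is primitive if $F=F_1F_2$ with $F_1,F_2\in\mathcal{S}$ implies $F_1=1$ or $F_2=1$. For a primitive Dirichlet character $\chi$,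 $F^\chi(s)=\sum_{n\ge1} a_n\chi(n)n^{ -s}$. Sums over $p$ are over primes. Selberg's conjectures: (A) Regularity of distribution: for each $F\in\mathcal{S}$ with coefficients $a_n$ there is an integer $n_F$ such that $\sum_{p\le x}|a_p|^2/p=n_F\log\log x+O(1)$. (B) Orthonormality: if $F$ and $F'$ (with coefficients $a_n$ and $a'_n$) are distinct and primitive, then $n_F=1$ and $\sum_{p\le x}a_p\overline{a'_p}/p=O(1)$. (C) $GL(1)$ twists: if $\chi$ is a primitive Dirichlet character, $F$ and $F^\chi$ are in $\mathcal{S}$, and $F=\prod_{i=1}^kF_i$ with the $F_i$ primitive, then $F^\chi=\prod_{i=1}^kF_i^\chi$ and the $F_i^\chi$ are also primitive elements of $\mathcal{S}$. -}

module Defs where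

open import Algebra.Bundles.Raw using (RawMonoid; RawRing)
open import Algebra.Core using (Op₁; Op₂)
open import Algebra.Structures using (IsCommutativeRing)
import Algebra.Definitions.RawMonoid as RawMonoidDefs
import Algebra.Definitions.RawSemiring as RawSemiringDefs
open import Axiom.ExcludedMiddle using (ExcludedMiddle)
open import Data.Bool.Base using (if_then_else_)
open import Data.Fin.Base using (Fin; toℕ)
open import Data.Integer.Base as ℤ using (ℤ; -[1+_])
open import Data.List.Base using (foldr; map; filter; upTo)
open import Data.Nat.Base as ℕ using (ℕ; zero; suc; _!)
open import Data.Nat.Coprimality using (Coprime)
open import Data.Nat.Divisibility using (_∣_; _∣?_)
open import Data.Nat.DivMod using (_/_)
open import Data.Nat.Primality using (Prime; prime?)
open import Data.Product.Base using (∃; ∃₂; _×_; _,_; proj₁)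
open import Data.Sum.Base using (_⊎_)
open import Level using (0ℓ)
open import Relation.Binary.Core using (Rel)
open import Relation.Binary.PropositionalEquality.Core using (_≡_)
open import Relation.Binary.Structures using (IsTotalOrder)
import Relation.Binary.Construct.NonStrictToStrict as ToStrict
open import Relation.Nullary using (¬_; yes; no; does)

-- The real numbers, characterised up to isomorphism as a Dedekind-complete
-- ordered field.  Equality is a setoid equality, so that classes of Cauchy
-- sequences or cuts are admissible models.  The value of 0# ⁻¹ is arbitrary.
record CompleteOrderedField : Set₁ where
  infix  9 _⁻¹
  infix  8 -_
  infixl 7 _*_
  infixl 6 _+_ _-_
  infix  4 _≈_ _≤_
  field
    Carrier : Set
    _≈_     : Rel Carrier 0ℓ
    _≤_     : Rel Carrier 0ℓ
    _+_     : Op₂ Carrier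
    _*_     : Op₂ Carrier
    -_      : Op₁ Carrier
    _⁻¹     : Op₁ Carrier
    0#      : Carrier
    1#      : Carrier

    isCommutativeRing : IsCommutativeRing _≈_ _+_ _*_ -_ 0# 1#
    0≉1               : ¬ 0# ≈ 1#
    ⁻¹-cong           : ∀ {x y} → x ≈ y → x ⁻¹ ≈ y ⁻¹
    *-inverseʳ        : ∀ x → ¬ x ≈ 0# → x * x ⁻¹ ≈ 1#

    isTotalOrder      : IsTotalOrder _≈_ _≤_
    +-monoˡ-≤         : ∀ z {x y} → x ≤ y → x + z ≤ y + z
    *-nonNegative     : ∀ {x y} → 0# ≤ x → 0# ≤ y → 0# ≤ x * y

    supremum : (P : Carrier → Set) → ∃ P →
               (∃ λ b → ∀ x → P x → x ≤ b) →
               ∃ λ s → (∀ x → P x → x ≤ s) ×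
                       (∀ b → (∀ x → P x → x ≤ b) → s ≤ b)

  open ToStrict _≈_ _≤_ public using (_<_)

  _-_ : Op₂ Carrier
  x - y = x + - y

  rawRing : RawRing 0ℓ 0ℓ
  rawRing = record
    { Carrier = Carrier ; _≈_ = _≈_ ; _+_ = _+_ ; _*_ = _*_
    ; -_ = -_ ; 0# = 0# ; 1# = 1# }

module Selberg (em : ExcludedMiddle 0ℓ) (real : CompleteOrderedField) where

  open CompleteOrderedField real renaming (Carrier to ℝ)
  private module ℝ-Raw = RawSemiringDefs (RawRing.rawSemiring rawRing)

  -- Definite description: some element satisfying P if there is one, and the
  -- junk value d otherwise.  It is used only for P determining its element
  -- up to equality.
  the : {A : Set} → (A → Set) → A → A
  the P d with em {∃ P}
  ... | yes (x , _) = x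
  ... | no  _       = d

  fromℕ : ℕ → ℝ
  fromℕ n = n ℝ-Raw.× 1#

  fromℤ : ℤ → ℝ
  fromℤ (ℤ.+ n)  = fromℕ n
  fromℤ -[1+ n ] = - fromℕ (suc n)

  sqrt : ℝ → ℝ
  sqrt x = the (λ r → 0# ≤ r × r * r ≈ x) 0#

  -- Integer part of a non-negative real, and 0 for negative arguments.
  ⌊_⌋ : ℝ → ℕ
  ⌊ x ⌋ = the (λ n → fromℕ n ≤ x × x < fromℕ (suc n)) 0

  ------------------------------------------------------------------------
  -- Complex numbers

  infix 5 _+i_
  record ℂ : Set where
    constructor _+i_
    field
      Re : ℝ
      Im : ℝ
  open ℂ public

  infix  9 _⁻¹ᶜ
  infix  8 -ᶜ_
  infixl 7 _*ᶜ_
  infixl 6 _+ᶜ_ _-ᶜ_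
  infix  4 _≈ᶜ_ _≉ᶜ_

  _≈ᶜ_ _≉ᶜ_ : Rel ℂ 0ℓ
  z ≈ᶜ w = Re z ≈ Re w × Im z ≈ Im w
  z ≉ᶜ w = ¬ z ≈ᶜ w

  ofℝ : ℝ → ℂ
  ofℝ x = x +i 0#

  0ᶜ 1ᶜ : ℂ
  0ᶜ = ofℝ 0#
  1ᶜ = ofℝ 1#

  _+ᶜ_ _*ᶜ_ : Op₂ ℂ
  z +ᶜ w = (Re z + Re w) +i (Im z + Im w)
  z *ᶜ w = (Re z * Re w - Im z * Im w) +i (Re z * Im w + Im z * Re w)

  -ᶜ_ conj : Op₁ ℂ
  -ᶜ z   = (- Re z) +i (- Im z)
  conj z = Re z +i (- Im z)

  _-ᶜ_ : Op₂ ℂ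
  z -ᶜ w = z +ᶜ (-ᶜ w)

  ∣_∣² : ℂ → ℝ
  ∣ z ∣² = Re z * Re z + Im z * Im z

  ∣_∣ : ℂ → ℝ
  ∣ z ∣ = sqrt ∣ z ∣²

  _⁻¹ᶜ : Op₁ ℂ
  z ⁻¹ᶜ = conj z *ᶜ ofℝ (∣ z ∣² ⁻¹)

  ℂ-rawRing : RawRing 0ℓ 0ℓ
  ℂ-rawRing = record
    { Carrier = ℂ ; _≈_ = _≈ᶜ_ ; _+_ = _+ᶜ_ ; _*_ = _*ᶜ_
    ; -_ = -ᶜ_ ; 0# = 0ᶜ ; 1# = 1ᶜ }

  open RawSemiringDefs (RawRing.rawSemiring ℂ-rawRing) public
    using () renaming (sum to ∑; product to ∏; _^_ to _^ᶜ_)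

  natᶜ : ℕ → ℂ
  natᶜ n = ofℝ (fromℕ n)

  ------------------------------------------------------------------------
  -- Limits and special functions

  Converges : (ℕ → ℂ) → ℂ → Set
  Converges u l = ∀ ε → 0# < ε → ∃ λ N → ∀ n → N ℕ.≤ n → ∣ u n -ᶜ l ∣ < ε

  lim : (ℕ → ℂ) → ℂ
  lim u = the (Converges u) 0ᶜ

  cexp : ℂ → ℂ
  cexp z = lim λ N → ∑ {N} λ i → z ^ᶜ toℕ i *ᶜ natᶜ (toℕ i !) ⁻¹ᶜ

  exp : ℝ → ℝ
  exp x = Re (cexp (ofℝ x))

  -- Meaningful for positive arguments only.
  log : ℝ → ℝ
  log x = the (λ y → exp y ≈ x) 0#

  -- Complex and real powers of a positive real.
  cpow : ℝ → ℂ → ℂ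
  cpow x s = cexp (s *ᶜ ofℝ (log x))

  rpow : ℝ → ℝ → ℝ
  rpow x y = exp (y * log x)

  -- Gauss's product: Γ(z) = lim n! n^z / (z (z+1) ⋯ (z+n)),
  -- valid for every z that is not a pole.
  Γ : ℂ → ℂ
  Γ z = lim λ n → natᶜ (n !) *ᶜ cpow (fromℕ n) z
                    *ᶜ (∏ {suc n} λ j → z +ᶜ natᶜ (toℕ j)) ⁻¹ᶜ

  Γ-Pole : ℂ → Set
  Γ-Pole z = ∃ λ n → z +ᶜ natᶜ n ≈ᶜ 0ᶜ

  HasDerivativeAt : (ℂ → ℂ) → ℂ → ℂ → Set
  HasDerivativeAt f z d =
    ∀ ε → 0# < ε → ∃ λ δ → 0# < δ × (∀ w → ∣ w -ᶜ z ∣ < δ →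
      ∣ (f w -ᶜ f z) -ᶜ d *ᶜ (w -ᶜ z) ∣ ≤ ε * ∣ w -ᶜ z ∣)

  Entire : (ℂ → ℂ) → Set
  Entire f = ∀ z → ∃ λ d → HasDerivativeAt f z d

  FiniteOrder : (ℂ → ℂ) → Set
  FiniteOrder f = ∃ λ ρ → ∃₂ λ C r → ∀ z → r ≤ ∣ z ∣ →
    ∣ f z ∣ ≤ C * exp (rpow ∣ z ∣ ρ)

  -- f(x) = O(1) as x → ∞.
  IsO1 : (ℝ → ℂ) → Set
  IsO1 f = ∃₂ λ C x₀ → ∀ x → x₀ ≤ x → ∣ f x ∣ ≤ C

  -- a_n ≪ n^θ.
  _≪n^_ : (ℕ → ℂ) → ℝ → Set
  a ≪n^ θ = ∃ λ C → ∀ n → 1 ℕ.≤ n → ∣ a n ∣ ≤ C * rpow (fromℕ n) θ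

  ------------------------------------------------------------------------
  -- Dirichlet series

  -- The series ∑_{n≥1} a_n n^{-s} is given by its coefficients n ↦ a_n;
  -- the value at n = 0 carries no meaning and is ignored by _≈ᴰ_.
  DirichletSeries : Set
  DirichletSeries = ℕ → ℂ

  infix 4 _≈ᴰ_ _≉ᴰ_
  _≈ᴰ_ _≉ᴰ_ : Rel DirichletSeries 0ℓ
  a ≈ᴰ b = ∀ n → 1 ℕ.≤ n → a n ≈ᶜ b n
  a ≉ᴰ b = ¬ a ≈ᴰ b

  1ᴰ : DirichletSeries
  1ᴰ 1 = 1ᶜ
  1ᴰ _ = 0ᶜ

  -- The coefficient of n^{-s} in the product of two Dirichlet series is
  -- ∑_{d∣n} a_d b_{n/d}; here d = 1 + i runs through 1, …, n.
  infixl 7 _*ᴰ_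
  _*ᴰ_ : Op₂ DirichletSeries
  (a *ᴰ b) n = ∑ {n} λ i →
    if does (suc (toℕ i) ∣? n) then a (suc (toℕ i)) *ᶜ b (n / suc (toℕ i))
                               else 0ᶜ

  DirichletSeries-rawMonoid : RawMonoid 0ℓ 0ℓ
  DirichletSeries-rawMonoid = record
    { Carrier = DirichletSeries ; _≈_ = _≈ᴰ_ ; _∙_ = _*ᴰ_ ; ε = 1ᴰ }

  private module ᴰ = RawMonoidDefs DirichletSeries-rawMonoid

  infixr 8 _^ᴰ_
  _^ᴰ_ : DirichletSeries → ℕ → DirichletSeries
  a ^ᴰ n = n ᴰ.× a

  ∏ᴰ : ∀ {k} → (Fin k → DirichletSeries) → DirichletSeries
  ∏ᴰ = ᴰ.sum

  partialSum : DirichletSeries → ℂ → ℕ → ℂ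
  partialSum a s N =
    ∑ {N} λ i → a (suc (toℕ i)) *ᶜ cpow (fromℕ (suc (toℕ i))) (-ᶜ s)

  -- The sum of the series, for s in its domain of convergence.
  ⟦_⟧ : DirichletSeries → ℂ → ℂ
  ⟦ a ⟧ s = lim (partialSum a s)

  ------------------------------------------------------------------------
  -- The Selberg class

  -- The data of γ(s) = ε Q^s ∏_{i<k} Γ(w_i s + μ_i).
  record GammaFactor : Set where
    field
      k     : ℕ
      ε     : ℂ
      Q     : ℝ
      w     : Fin k → ℝ
      μ     : Fin k → ℂ
      ∣ε∣≈1 : ∣ ε ∣ ≈ 1#
      Q>0   : 0# < Q
      w>0   : ∀ i → 0# < w i
      Reμ≥0 : ∀ i → 0# ≤ Re (μ i)

    argument : Fin k → ℂ → ℂ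
    argument i s = ofℝ (w i) *ᶜ s +ᶜ μ i

    γ : ℂ → ℂ
    γ s = ε *ᶜ cpow Q s *ᶜ ∏ λ i → Γ (argument i s)

  -- If G is the entire continuation of (s-1)^m F(s), then F(s) is continued
  -- as G(s) / (s-1)^m for s ≠ 1.
  continued : ℕ → (ℂ → ℂ) → ℂ → ℂ
  continued m G s = G s *ᶜ ((s -ᶜ 1ᶜ) ^ᶜ m) ⁻¹ᶜ

  module _ (m : ℕ) (G : ℂ → ℂ) (gf : GammaFactor) where
    open GammaFactor gf

    Φ : ℂ → ℂ
    Φ s = γ s *ᶜ continued m G s

    record Φ-Defined (s : ℂ) : Set where
      field
        s≉1    : s ≉ᶜ 1ᶜ
        noPole : ∀ i → ¬ Γ-Pole (argument i s)

    -- Φ(s) = conj (Φ (conj (1 - s))) is an identity of meromorphic functions;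
    -- it is required wherever no factor on either side has a pole.
    FunctionalEquation : Set
    FunctionalEquation = ∀ s → Φ-Defined s → Φ-Defined (1ᶜ -ᶜ conj s) →
                         Φ s ≈ᶜ conj (Φ (1ᶜ -ᶜ conj s))

  -- log F(s) = ∑ b_n n^{-s} is read as F(s) = exp (∑ b_n n^{-s}); since b₁ = 0
  -- this is the branch tending to 0 as Re s → ∞.
  EulerProduct : DirichletSeries → Set
  EulerProduct a =
    a 1 ≈ᶜ 1ᶜ ×
    ∃ λ (b : DirichletSeries) →
      (∀ n → 1 ℕ.≤ n →
         ¬ (∃₂ λ p j → Prime p × 1 ℕ.≤ j × n ≡ p ℕ.^ j) → b n ≈ᶜ 0ᶜ) ×
      (∃ λ θ → θ + θ < 1# × b ≪n^ θ) ×
      (∀ s → 1# < Re s →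
         ∃ λ l → Converges (partialSum b s) l × ⟦ a ⟧ s ≈ᶜ cexp l)

  Continuation : DirichletSeries → ℕ → (ℂ → ℂ) → Set
  Continuation a m G =
    Entire G × FiniteOrder G ×
    (∀ s → 1# < Re s → G s ≈ᶜ (s -ᶜ 1ᶜ) ^ᶜ m *ᶜ ⟦ a ⟧ s)

  Ramanujan : DirichletSeries → Set
  Ramanujan a = ∀ ε → 0# < ε → a ≪n^ ε

  -- Nested products rather than records, as Agda would fully normalise the
  -- field types of a record, which is infeasible here.
  𝒮 : DirichletSeries → Set
  𝒮 a =
    (∃₂ λ m G → Continuation a m G × ∃ (FunctionalEquation m G)) ×
    Ramanujan a ×
    EulerProduct a

  Primitive : DirichletSeries → Set
  Primitive F =
    𝒮 F × F ≉ᴰ 1ᴰ ×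
    (∀ F₁ F₂ → 𝒮 F₁ → 𝒮 F₂ → F ≈ᴰ F₁ *ᴰ F₂ → F₁ ≈ᴰ 1ᴰ ⊎ F₂ ≈ᴰ 1ᴰ)

  ------------------------------------------------------------------------
  -- Dirichlet characters and twists

  record IsDirichletCharacter (q : ℕ) (χ : ℕ → ℂ) : Set where
    field
      q≥1            : 1 ℕ.≤ q
      periodic       : ∀ n → χ (n ℕ.+ q) ≈ᶜ χ n
      multiplicative : ∀ m n → χ (m ℕ.* n) ≈ᶜ χ m *ᶜ χ n
      unit           : ∀ n → Coprime n q → χ n ≉ᶜ 0ᶜ
      nonUnit        : ∀ n → ¬ Coprime n q → χ n ≈ᶜ 0ᶜ

  record IsPrimitiveCharacter (q : ℕ) (χ : ℕ → ℂ) : Set where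
    field
      isDirichletCharacter : IsDirichletCharacter q χ
      notInduced : ∀ d χ′ → d ∣ q → d ℕ.< q → IsDirichletCharacter d χ′ →
                   ¬ (∀ n → Coprime n q → χ n ≈ᶜ χ′ n)

  twist : DirichletSeries → (ℕ → ℂ) → DirichletSeries
  twist a χ n = a n *ᶜ χ n

  ------------------------------------------------------------------------
  -- Selberg's conjectures

  -- ∑_{p≤x} f(p)
  ∑ₚ≤ : ℝ → (ℕ → ℂ) → ℂ
  ∑ₚ≤ x f = foldr _+ᶜ_ 0ᶜ (map f (filter prime? (upTo (suc ⌊ x ⌋))))

  ConjectureA : Set
  ConjectureA = ∀ a → 𝒮 a → ∃ λ (n : ℤ) → IsO1 λ x →
    (∑ₚ≤ x λ p → ofℝ (∣ a p ∣² * fromℕ p ⁻¹))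
      -ᶜ ofℝ (fromℤ n * log (log x))

  -- The integer n_F.
  n[_] : ConjectureA → ∀ F → 𝒮 F → ℤ
  n[ A ] F F∈𝒮 = proj₁ (A F F∈𝒮)

  -- Distinctness concerns the second clause only; n_F = 1 is a property of each
  -- primitive F.
  ConjectureB : ConjectureA → Set
  ConjectureB A =
    (∀ F (F-prim : Primitive F) → n[ A ] F (proj₁ F-prim) ≡ ℤ.+ 1) ×
    (∀ a a′ → Primitive a → Primitive a′ → a ≉ᴰ a′ →
       IsO1 λ x → ∑ₚ≤ x λ p → a p *ᶜ conj (a′ p) *ᶜ ofℝ (fromℕ p ⁻¹))

  ConjectureC : Set
  ConjectureC = ∀ q χ → IsPrimitiveCharacter q χ →
    ∀ F → 𝒮 F → 𝒮 (twist F χ) →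
    ∀ {k} (Fs : Fin k → DirichletSeries) → (∀ i → Primitive (Fs i)) →
    F ≈ᴰ ∏ᴰ Fs →
    twist F χ ≈ᴰ ∏ᴰ (λ i → twist (Fs i) χ) ×
    (∀ i → Primitive (twist (Fs i) χ))

{-# OPTIONS --safe #-}
-- For a normalised product, prime coefficients add: a_p = ∑ e_i a_p(F_i).
-- So ∑_{p≤x} |a_p|²/p expands bilinearly into the sums ∑_{p≤x} a_p(F_i) conj a_p(F_j) / p,
-- which are δ_ij log log x + O(1) by (A) and (B).  Comparison with (A) for F gives
-- (n_F - ∑ e_i²) log log x = O(1), and log log is unbounded.
-- The last point rests on exp (defined by its series, log being its inverse by
-- description) taking each value exp y with y > 0 only once.
module Submission where

open import Defs
open import Algebra.Bundles using (CommutativeRing; Semiring)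
open import Algebra.Bundles.Raw using (RawRing)
import Algebra.Definitions.RawSemiring as RawSemiringDefs
import Algebra.Properties.Ring as RingProperties
import Algebra.Properties.Semiring.Mult.TCOptimised as Mult′
import Algebra.Solver.Ring as RingSolver
open import Algebra.Solver.Ring.AlmostCommutativeRing using (_-Raw-AlmostCommutative⟶_; fromCommutativeRing)
open import Axiom.ExcludedMiddle using (ExcludedMiddle)
open import Data.Bool.Base using (if_then_else_)
open import Data.Fin.Base using (Fin; zero; suc; toℕ)
import Data.Fin.Properties as Fin
open import Data.Integer.Base as ℤ using (ℤ; -[1+_]; +_; _⊖_)
import Data.Integer.Properties as ℤ
open import Data.List.Base using ([]; _∷_; foldr; map; filter; upTo)
open import Data.List.Relation.Unary.All using (All; []; _∷_)
open import Data.List.Relation.Unary.All.Properties using (all-filter)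
import Data.Maybe.Base as Maybe
open import Data.Nat.Base as ℕ using (ℕ; zero; suc; _!; +-0-rawMonoid)
open import Data.Nat.Divisibility using (_∣_; _∣?_; ∣-refl; 1∣_)
open import Data.Nat.DivMod using (_/_; n/1≡n; n/n≡1)
open import Data.Nat.Primality using (Prime; prime?; prime⇒irreducible; prime⇒nonTrivial; prime⇒nonZero)
import Data.Nat.Properties as ℕ
open import Algebra.Definitions.RawMonoid +-0-rawMonoid using (sum)
open import Algebra.Properties.Monoid.Sum ℕ.+-0-monoid using (sum-cong-≗)
open import Data.Product.Base using (∃; ∃₂; _×_; _,_; proj₁; proj₂)
open import Data.Sign.Base as Sign using (Sign)
open import Data.Sum.Base using (_⊎_; inj₁; inj₂)
open import Function.Base using (_∘_)
open import Level using (0ℓ)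
open import Relation.Binary.Bundles using (Poset)
import Relation.Binary.Construct.NonStrictToStrict as ToStrict
open import Relation.Binary.Definitions using (tri<; tri≈; tri>)
open import Relation.Binary.PropositionalEquality.Core as ≡ using (_≡_; _≢_)
import Relation.Binary.Reasoning.PartialOrder as PosetReasoning
import Relation.Binary.Reasoning.Setoid as SetoidReasoning
open import Relation.Binary.Structures using (IsTotalOrder)
open import Relation.Nullary using (¬_; yes; no; contradiction; does)
open import Relation.Nullary.Decidable using (dec-true; dec-false; dec⇒maybe)

-- Only the real parts of the sums in (A) and (B) are compared: Re (z conj w) is symmetric, so
-- conjugation disappears from the expansion. Distinct integers differ by at least 1, so two
-- different coefficients of log log x for the same sum would bound log log x. The obstacle is that
-- log log x is a description applied to another description, and a value becomes known only by
-- inverting exp uniquely. The test points are x = exp (exp M), where log log x = M. Every other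
-- real preimage has to be excluded, negative ones included, where the series alternates and its
-- value might be the default 0 of `lim`. The bound at negative arguments comes from a finite form
-- of exp x · exp (-x) = 1, in which every partial sum of the Cauchy product is 1; the remaining
-- estimates compare series with nonnegative terms.

-- Integer coefficients let the solver cancel x + - x, which it cannot do with
-- coefficients in a ring whose equality is undecidable.
module IntegerCoefficients {c ℓ} (R : CommutativeRing c ℓ) where
  open CommutativeRing R
  open RingProperties ring using (-0#≈0#; -‿involutive; -‿+-comm; -‿distribˡ-*; -‿distribʳ-*)
  open Mult′ semiring using (1+×; ×-homo-+; ×1-homo-*) renaming (_×_ to _×′_)
  open SetoidReasoning setoid

  -- The optimised multiple `1 ×′ x` reduces to `x`, which makes `1-homo` in `morphism` hold by
  -- `refl`.
  fromℤ : ℤ → Carrier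
  fromℤ (+ n)    = n ×′ 1#
  fromℤ -[1+ n ] = - (suc n ×′ 1#)

  fromℤ-⊖ : ∀ m n → fromℤ (m ⊖ n) ≈ m ×′ 1# - n ×′ 1#
  fromℤ-⊖ zero    zero    = sym (-‿inverseʳ 0#)
  fromℤ-⊖ zero    (suc n) = sym (+-identityˡ _)
  fromℤ-⊖ (suc m) zero    = sym (trans (+-congˡ -0#≈0#) (+-identityʳ _))
  fromℤ-⊖ (suc m) (suc n) = begin
    fromℤ (suc m ⊖ suc n)              ≡⟨ ≡.cong fromℤ (ℤ.[1+m]⊖[1+n]≡m⊖n m n) ⟩
    fromℤ (m ⊖ n)                      ≈⟨ fromℤ-⊖ m n ⟩
    a - b                              ≈⟨ +-identityˡ _ ⟨
    0# + (a - b)                       ≈⟨ +-congʳ (-‿inverseʳ 1#) ⟨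
    (1# - 1#) + (a - b)                ≈⟨ +-assoc _ _ _ ⟩
    1# + (- 1# + (a - b))              ≈⟨ +-congˡ (+-assoc _ _ _) ⟨
    1# + ((- 1# + a) - b)              ≈⟨ +-congˡ (+-congʳ (+-comm _ _)) ⟩
    1# + ((a - 1#) - b)                ≈⟨ +-congˡ (+-assoc _ _ _) ⟩
    1# + (a + (- 1# - b))              ≈⟨ +-assoc _ _ _ ⟨
    (1# + a) + (- 1# - b)              ≈⟨ +-congˡ (-‿+-comm _ _) ⟩
    (1# + a) - (1# + b)                ≈⟨ +-cong (1+× m 1#) (-‿cong (1+× n 1#)) ⟨
    suc m ×′ 1# - suc n ×′ 1#          ∎
    where
    a = m ×′ 1#
    b = n ×′ 1#

  fromℤ-neg : ∀ i → fromℤ (ℤ.- i) ≈ - fromℤ i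
  fromℤ-neg (+ zero)  = sym -0#≈0#
  fromℤ-neg (+ suc n) = refl
  fromℤ-neg -[1+ n ]  = sym (-‿involutive _)

  fromℤ-+ : ∀ i j → fromℤ (i ℤ.+ j) ≈ fromℤ i + fromℤ j
  fromℤ-+ (+ m)    (+ n)    = ×-homo-+ 1# m n
  fromℤ-+ (+ m)    -[1+ n ] = fromℤ-⊖ m (suc n)
  fromℤ-+ -[1+ m ] (+ n)    = trans (fromℤ-⊖ n (suc m)) (+-comm _ _)
  fromℤ-+ -[1+ m ] -[1+ n ] = begin
    - (suc (suc (m ℕ.+ n)) ×′ 1#)       ≡⟨ ≡.cong (λ k → - (suc k ×′ 1#)) (≡.sym (ℕ.+-suc m n)) ⟩
    - ((suc m ℕ.+ suc n) ×′ 1#)         ≈⟨ -‿cong (×-homo-+ 1# (suc m) (suc n)) ⟩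
    - (suc m ×′ 1# + suc n ×′ 1#)       ≈⟨ -‿+-comm _ _ ⟨
    - (suc m ×′ 1#) - suc n ×′ 1#       ∎


  fromℤ-* : ∀ i j → fromℤ (i ℤ.* j) ≈ fromℤ i * fromℤ j
  fromℤ-* (+ m) (+ n) = begin
    fromℤ (Sign.+ ℤ.◃ m ℕ.* n)          ≡⟨ ≡.cong fromℤ (ℤ.+◃n≡+n (m ℕ.* n)) ⟩
    (m ℕ.* n) ×′ 1#                     ≈⟨ ×1-homo-* m n ⟩
    m ×′ 1# * n ×′ 1#                   ∎
  fromℤ-* (+ m) -[1+ n ] = begin
    fromℤ (Sign.- ℤ.◃ m ℕ.* suc n)      ≡⟨ ≡.cong fromℤ (ℤ.-◃n≡-n (m ℕ.* suc n)) ⟩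
    fromℤ (ℤ.- + (m ℕ.* suc n))         ≈⟨ fromℤ-neg (+ (m ℕ.* suc n)) ⟩
    - ((m ℕ.* suc n) ×′ 1#)             ≈⟨ -‿cong (×1-homo-* m (suc n)) ⟩
    - (m ×′ 1# * suc n ×′ 1#)           ≈⟨ -‿distribʳ-* _ _ ⟩
    m ×′ 1# * - (suc n ×′ 1#)           ∎
  fromℤ-* -[1+ m ] (+ n) = begin
    fromℤ (Sign.- ℤ.◃ suc m ℕ.* n)      ≡⟨ ≡.cong fromℤ (ℤ.-◃n≡-n (suc m ℕ.* n)) ⟩
    fromℤ (ℤ.- + (suc m ℕ.* n))         ≈⟨ fromℤ-neg (+ (suc m ℕ.* n)) ⟩
    - ((suc m ℕ.* n) ×′ 1#)             ≈⟨ -‿cong (×1-homo-* (suc m) n) ⟩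
    - (suc m ×′ 1# * n ×′ 1#)           ≈⟨ -‿distribˡ-* _ _ ⟩
    - (suc m ×′ 1#) * n ×′ 1#           ∎
  fromℤ-* -[1+ m ] -[1+ n ] = begin
    (suc m ℕ.* suc n) ×′ 1#             ≈⟨ ×1-homo-* (suc m) (suc n) ⟩
    a * b                               ≈⟨ -‿involutive _ ⟨
    - - (a * b)                         ≈⟨ -‿cong (-‿distribˡ-* a b) ⟩
    - (- a * b)                         ≈⟨ -‿distribʳ-* (- a) b ⟩
    - a * - b                           ∎
    where
    a = suc m ×′ 1#
    b = suc n ×′ 1#

  morphism : ℤ.+-*-rawRing -Raw-AlmostCommutative⟶ fromCommutativeRing R
  morphism = record
    { ⟦_⟧ = fromℤ ; +-homo = fromℤ-+ ; *-homo = fromℤ-* ; -‿homo = fromℤ-neg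
    ; 0-homo = refl ; 1-homo = refl }

  open RingSolver ℤ.+-*-rawRing (fromCommutativeRing R) morphism
    (λ i j → Maybe.map (λ i≡j → reflexive (≡.cong fromℤ i≡j)) (dec⇒maybe (i ℤ.≟ j))) public
    using (solve; _:=_; _:+_; _:*_; :-_; _:-_; con)

-- Arithmetic in an ordered field and the Archimedean property

module OrderedField (em : ExcludedMiddle 0ℓ) (real : CompleteOrderedField) where
  open Selberg em real using (fromℕ; the)
  open CompleteOrderedField real using (_<_; supremum; isTotalOrder; _≤_; _⁻¹; *-inverseʳ; 0≉1; +-monoˡ-≤; *-nonNegative)

  commutativeRing : CommutativeRing 0ℓ 0ℓ
  commutativeRing = record { isCommutativeRing = CompleteOrderedField.isCommutativeRing real }

  open CommutativeRing commutativeRing public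
    using (_≈_; _+_; _*_; -_; _-_; 0#; 1#; refl; sym; trans; reflexive; semiring;
           +-cong; +-congˡ; +-congʳ; *-cong; *-congˡ; *-congʳ; -‿cong;
           +-identityˡ; +-identityʳ; *-identityˡ; *-identityʳ; +-comm; *-comm; +-assoc; *-assoc;
           zeroˡ; zeroʳ; distribˡ; distribʳ; -‿inverseʳ)
    renaming (Carrier to ℝ)
  open IntegerCoefficients commutativeRing public hiding (fromℤ)
  open IsTotalOrder isTotalOrder public using (total; isPartialOrder; antisym; ≤-respˡ-≈; ≤-respʳ-≈)
    renaming (refl to ≤-refl; trans to ≤-trans; reflexive to ≤-reflexive)

  poset : Poset 0ℓ 0ℓ 0ℓ
  poset = record { isPartialOrder = isPartialOrder }

  module ≤-Reasoning = PosetReasoning poset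

  private module < = ToStrict _≈_ _≤_

  <-≤-trans : ∀ {x y z} → x < y → y ≤ z → x < z
  <-≤-trans = <.<-≤-trans sym ≤-trans antisym ≤-respʳ-≈

  ≤-<-trans : ∀ {x y z} → x ≤ y → y < z → x < z
  ≤-<-trans = <.≤-<-trans ≤-trans antisym ≤-respˡ-≈

  <⇒≱ : ∀ {x y} → x < y → ¬ y ≤ x
  <⇒≱ = <.<⇒≱ antisym

  <-respʳ-≈ : ∀ {x y z} → y ≈ z → x < y → x < z
  <-respʳ-≈ y≈z (x≤y , x≉y) = ≤-respʳ-≈ y≈z x≤y , λ x≈z → x≉y (trans x≈z (sym y≈z))

  <⇒≤ : ∀ {x y} → x < y → x ≤ y
  <⇒≤ = proj₁

  <-≤-connex : ∀ x y → x < y ⊎ y ≤ x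
  <-≤-connex x y with total x y | em {x ≈ y}
  ... | inj₂ y≤x | _       = inj₂ y≤x
  ... | inj₁ x≤y | yes x≈y = inj₂ (≤-reflexive (sym x≈y))
  ... | inj₁ x≤y | no  x≉y = inj₁ (x≤y , x≉y)

  ≮⇒≥ : ∀ {x y} → ¬ x < y → y ≤ x
  ≮⇒≥ {x} {y} x≮y with <-≤-connex x y
  ... | inj₁ x<y = contradiction x<y x≮y
  ... | inj₂ y≤x = y≤x

  -- An inequality a ≤ b is reduced to the nonnegativity of a term that the
  -- ring solver identifies with b - a.
  ≤⇒0≤- : ∀ {a b} → a ≤ b → 0# ≤ b - a
  ≤⇒0≤- {a} a≤b = ≤-respˡ-≈ (-‿inverseʳ a) (+-monoˡ-≤ (- a) a≤b)

  ≤-by : ∀ {a b h} → 0# ≤ h → b ≈ a + h → a ≤ b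
  ≤-by {a} {b} {h} 0≤h b≈a+h = begin
    a       ≈⟨ +-identityˡ a ⟨
    0# + a  ≤⟨ +-monoˡ-≤ a 0≤h ⟩
    h + a   ≈⟨ +-comm h a ⟩
    a + h   ≈⟨ b≈a+h ⟨
    b       ∎
    where open ≤-Reasoning

  <⇒0<- : ∀ {a b} → a < b → 0# < b - a
  <⇒0<- {a} {b} (a≤b , a≉b) = ≤⇒0≤- a≤b , λ 0≈b-a → a≉b (begin-equality
    a            ≈⟨ +-identityʳ a ⟨
    a + 0#       ≈⟨ +-congˡ 0≈b-a ⟩
    a + (b - a)  ≈⟨ solve 2 (λ a b → a :+ (b :- a) := b) refl a b ⟩
    b            ∎)
    where open ≤-Reasoning

  <-by : ∀ {a b h} → 0# < h → b ≈ a + h → a < b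
  <-by {a} {b} {h} (0≤h , 0≉h) b≈a+h = ≤-by 0≤h b≈a+h , λ a≈b → 0≉h (begin-equality
    0#           ≈⟨ -‿inverseʳ a ⟨
    a - a        ≈⟨ +-congʳ (trans a≈b b≈a+h) ⟩
    (a + h) - a  ≈⟨ solve 2 (λ a h → (a :+ h) :- a := h) refl a h ⟩
    h            ∎)
    where open ≤-Reasoning

  0≤+ : ∀ {a b} → 0# ≤ a → 0# ≤ b → 0# ≤ a + b
  0≤+ {a} {b} 0≤a 0≤b = ≤-trans 0≤a (≤-by 0≤b refl)

  0<+ : ∀ {a b} → 0# < a → 0# ≤ b → 0# < a + b
  0<+ {a} {b} 0<a 0≤b = <-≤-trans 0<a (≤-by 0≤b refl)

  0≤* : ∀ {a b} → 0# ≤ a → 0# ≤ b → 0# ≤ a * b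
  0≤* = *-nonNegative

  0<* : ∀ {a b} → 0# < a → 0# < b → 0# < a * b
  0<* {a} {b} (0≤a , 0≉a) (0≤b , 0≉b) = 0≤* 0≤a 0≤b , λ 0≈ab → 0≉b (begin-equality
    0#              ≈⟨ zeroʳ (a ⁻¹) ⟨
    a ⁻¹ * 0#       ≈⟨ *-congˡ 0≈ab ⟩
    a ⁻¹ * (a * b)  ≈⟨ solve 3 (λ i a b → i :* (a :* b) := (a :* i) :* b) refl (a ⁻¹) a b ⟩
    (a * a ⁻¹) * b  ≈⟨ *-congʳ (*-inverseʳ a (λ a≈0 → 0≉a (sym a≈0))) ⟩
    1# * b          ≈⟨ *-identityˡ b ⟩
    b               ∎)
    where open ≤-Reasoning

  0≤sq : ∀ a → 0# ≤ a * a
  0≤sq a with total 0# a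
  ... | inj₁ 0≤a = 0≤* 0≤a 0≤a
  ... | inj₂ a≤0 = ≤-respʳ-≈ (solve 1 (λ a → (con (+ 0) :- a) :* (con (+ 0) :- a) := a :* a) refl a)
                     (0≤* (≤⇒0≤- a≤0) (≤⇒0≤- a≤0))

  0<1 : 0# < 1#
  0<1 = ≤-respʳ-≈ (*-identityˡ 1#) (0≤sq 1#) , 0≉1

  +-mono-≤ : ∀ {a b c d} → a ≤ b → c ≤ d → a + c ≤ b + d
  +-mono-≤ {a} {b} {c} {d} a≤b c≤d = ≤-by (0≤+ (≤⇒0≤- a≤b) (≤⇒0≤- c≤d))
    (solve 4 (λ a b c d → b :+ d := (a :+ c) :+ ((b :- a) :+ (d :- c))) refl a b c d)

  *-monoˡ-≤ : ∀ {a b c} → 0# ≤ c → a ≤ b → c * a ≤ c * b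
  *-monoˡ-≤ {a} {b} {c} 0≤c a≤b = ≤-by (0≤* 0≤c (≤⇒0≤- a≤b))
    (solve 3 (λ a b c → c :* b := c :* a :+ c :* (b :- a)) refl a b c)

  neg-mono-≤ : ∀ {a b} → a ≤ b → - b ≤ - a
  neg-mono-≤ {a} {b} a≤b = ≤-by (≤⇒0≤- a≤b) (solve 2 (λ a b → :- a := :- b :+ (b :- a)) refl a b)

  ⁻¹-pos : ∀ {a} → 0# < a → 0# < a ⁻¹
  ⁻¹-pos {a} 0<a@(_ , 0≉a) with <-≤-connex 0# (a ⁻¹)
  ... | inj₁ 0<i = 0<i
  ... | inj₂ i≤0 = contradiction (begin
    1#           ≈⟨ *-inverseʳ a (λ a≈0 → 0≉a (sym a≈0)) ⟨
    a * a ⁻¹     ≤⟨ *-monoˡ-≤ (<⇒≤ 0<a) i≤0 ⟩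
    a * 0#       ≈⟨ zeroʳ a ⟩
    0#           ∎) (<⇒≱ 0<1)
    where open ≤-Reasoning

  2# ½ : ℝ
  2# = 1# + 1#
  ½  = 2# ⁻¹

  0<2 : 0# < 2#
  0<2 = 0<+ 0<1 (<⇒≤ 0<1)

  ½-pos : 0# < ½
  ½-pos = ⁻¹-pos 0<2

  ½+½ : ½ + ½ ≈ 1#
  ½+½ = begin-equality
    ½ + ½            ≈⟨ +-cong (*-identityˡ ½) (*-identityˡ ½) ⟨
    1# * ½ + 1# * ½  ≈⟨ distribʳ ½ 1# 1# ⟨
    2# * ½           ≈⟨ *-inverseʳ 2# (λ 2≈0 → proj₂ 0<2 (sym 2≈0)) ⟩
    1#               ∎
    where open ≤-Reasoning

  halve : ∀ {ε} → 0# < ε → ∃ λ δ → 0# < δ × δ + δ ≈ ε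
  halve {ε} 0<ε = ½ * ε , 0<* ½-pos 0<ε ,
    trans (sym (distribʳ ε ½ ½)) (trans (*-congʳ ½+½) (*-identityˡ ε))

  sq-cancel-< : ∀ {a b} → 0# ≤ a → 0# ≤ b → a * a < b * b → a < b
  sq-cancel-< {a} {b} 0≤a 0≤b aa<bb with <-≤-connex a b
  ... | inj₁ a<b = a<b
  ... | inj₂ b≤a = contradiction
    (≤-by (0≤+ (0≤* 0≤b (≤⇒0≤- b≤a)) (0≤* 0≤a (≤⇒0≤- b≤a)))
      (solve 2 (λ a b → a :* a := b :* b :+ (b :* (a :- b) :+ a :* (a :- b))) refl a b))
    (<⇒≱ aa<bb)

  -- Stated for `a` of either sign, so that it bounds both `Re z` and `- Re z` by `∣ z ∣`.
  sq-cancel-≤ : ∀ {a b} → 0# ≤ b → a * a ≤ b * b → a ≤ b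
  sq-cancel-≤ {a} {b} 0≤b aa≤bb with <-≤-connex b a
  ... | inj₂ a≤b = a≤b
  ... | inj₁ b<a = contradiction aa≤bb (<⇒≱
    (<-by (0<* (<-≤-trans (<⇒0<- b<a) (≤-by (0≤+ 0≤b 0≤b)
             (solve 2 (λ a b → a :+ b := (a :- b) :+ (b :+ b)) refl a b))) (<⇒0<- b<a))
      (solve 2 (λ a b → a :* a := b :* b :+ (a :+ b) :* (a :- b)) refl a b)))

  fromℕ-nonNeg : ∀ n → 0# ≤ fromℕ n
  fromℕ-nonNeg zero    = ≤-refl
  fromℕ-nonNeg (suc n) = 0≤+ (<⇒≤ 0<1) (fromℕ-nonNeg n)

  fromℕ-pos : ∀ n → 0# < fromℕ (suc n)
  fromℕ-pos n = 0<+ 0<1 (fromℕ-nonNeg n)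

  fromℕ-+ : ∀ m n → fromℕ (m ℕ.+ n) ≈ fromℕ m + fromℕ n
  fromℕ-+ zero    n = sym (+-identityˡ _)
  fromℕ-+ (suc m) n = trans (+-congˡ (fromℕ-+ m n)) (sym (+-assoc _ _ _))

  fromℕ-* : ∀ m n → fromℕ (m ℕ.* n) ≈ fromℕ m * fromℕ n
  fromℕ-* zero    n = sym (zeroˡ _)
  fromℕ-* (suc m) n = begin-equality
    fromℕ (n ℕ.+ m ℕ.* n)          ≈⟨ fromℕ-+ n (m ℕ.* n) ⟩
    fromℕ n + fromℕ (m ℕ.* n)      ≈⟨ +-congˡ (fromℕ-* m n) ⟩
    fromℕ n + fromℕ m * fromℕ n    ≈⟨ +-congʳ (*-identityˡ _) ⟨
    1# * fromℕ n + fromℕ m * fromℕ n ≈⟨ distribʳ _ _ _ ⟨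
    (1# + fromℕ m) * fromℕ n       ∎
    where open ≤-Reasoning

  fromℕ-mono-≤ : ∀ {m n} → m ℕ.≤ n → fromℕ m ≤ fromℕ n
  fromℕ-mono-≤ {n = n} ℕ.z≤n = fromℕ-nonNeg n
  fromℕ-mono-≤ (ℕ.s≤s m≤n) = +-mono-≤ ≤-refl (fromℕ-mono-≤ m≤n)

  -- If `x` exceeded every natural number, the naturals would have a supremum s. Since n + 1 ≤ s for
  -- every n, s - 1 would bound them as well.
  archimedean : ∀ x → ∃ λ n → x ≤ fromℕ n
  archimedean x with em {∃ λ n → x ≤ fromℕ n}
  ... | yes found = found
  ... | no  none  = contradiction s≤s-1 (<⇒≱ (<-by 0<1 (solve 2 (λ s o → s := (s :- o) :+ o) refl s 1#)))
    where
    IsNat : ℝ → Set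
    IsNat y = ∃ λ n → y ≈ fromℕ n

    bounded : ∀ y → IsNat y → y ≤ x
    bounded y (n , y≈n) = ≮⇒≥ λ x<y → none (n , ≤-respʳ-≈ y≈n (<⇒≤ x<y))

    sup = supremum IsNat (0# , 0 , refl) (x , bounded)
    s   = proj₁ sup

    s≤s-1 : s ≤ s - 1#
    s≤s-1 = proj₂ (proj₂ sup) (s - 1#) λ y (n , y≈n) → begin
      y                    ≈⟨ y≈n ⟩
      fromℕ n              ≈⟨ solve 2 (λ m o → m := (o :+ m) :- o) refl (fromℕ n) 1# ⟩
      fromℕ (suc n) - 1#   ≤⟨ +-monoˡ-≤ (- 1#) (proj₁ (proj₂ sup) _ (suc n , refl)) ⟩
      s - 1#               ∎
      where open ≤-Reasoning

  the-spec : {A : Set} (P : A → Set) (d : A) → ∃ P → P (the P d)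
  the-spec P d found with em {∃ P}
  ... | yes (x , px) = px
  ... | no  none     = contradiction found none

  the-spec? : {A : Set} (P : A → Set) (d : A) → P (the P d) ⊎ the P d ≡ d
  the-spec? P d with em {∃ P}
  ... | yes (x , px) = inj₁ px
  ... | no  none     = inj₂ ≡.refl

-- Existence of square roots

module SquareRoot (em : ExcludedMiddle 0ℓ) (real : CompleteOrderedField) where
  open Selberg em real using (sqrt)
  open CompleteOrderedField real using (_<_; supremum; _≤_; _⁻¹; *-inverseʳ)
  open OrderedField em real
  open ≤-Reasoning

  module _ {x : ℝ} (0≤x : 0# ≤ x) where
    private
      Below : ℝ → Set
      Below r = 0# ≤ r × r * r ≤ x

      r≤1+x : ∀ r → Below r → r ≤ 1# + x
      r≤1+x r (0≤r , rr≤x) = sq-cancel-≤ (0≤+ (<⇒≤ 0<1) 0≤x) (≤-trans rr≤x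
        (≤-by (0≤+ (0≤+ (0≤sq 1#) (0≤* (<⇒≤ 0<1) 0≤x)) (0≤sq x)) (begin-equality
          (1# + x) * (1# + x)                       ≈⟨ solve 2 (λ o x → (o :+ x) :* (o :+ x) := o :* x :+ (o :* o :+ o :* x :+ x :* x)) refl 1# x ⟩
          1# * x + (1# * 1# + 1# * x + x * x)       ≈⟨ +-congʳ (*-identityˡ x) ⟩
          x + (1# * 1# + 1# * x + x * x)            ∎)))

      sup = supremum Below (0# , ≤-refl , ≤-respˡ-≈ (sym (zeroˡ 0#)) 0≤x) (1# + x , r≤1+x)
      s   = proj₁ sup

      0≤s : 0# ≤ s
      0≤s = proj₁ (proj₂ sup) 0# (≤-refl , ≤-respˡ-≈ (sym (zeroˡ 0#)) 0≤x)

      -- For s > 0 the mean of s and x / s bounds Below, as its square is at least x.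
      ss≤x : s * s ≤ x
      ss≤x with <-≤-connex 0# s
      ... | inj₂ s≤0 = begin
        s * s    ≤⟨ *-monoˡ-≤ 0≤s s≤0 ⟩
        s * 0#   ≈⟨ zeroʳ s ⟩
        0#       ≤⟨ 0≤x ⟩
        x        ∎
      ... | inj₁ 0<s = begin
        s * s              ≈⟨ solve 1 (λ s → s :* s := s :* ((s :+ s) :- s)) refl s ⟩
        s * (s + s - s)    ≤⟨ *-monoˡ-≤ 0≤s (+-mono-≤ s+s≤s+q ≤-refl) ⟩
        s * (s + q - s)    ≈⟨ solve 2 (λ s q → s :* (s :+ q :- s) := s :* q) refl s q ⟩
        s * q              ≈⟨ sq≈x ⟩
        x                  ∎
        where
        q = x * s ⁻¹
        b = ½ * (s + q)

        sq≈x : s * q ≈ x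
        sq≈x = begin-equality
          s * (x * s ⁻¹)   ≈⟨ solve 3 (λ s x i → s :* (x :* i) := (s :* i) :* x) refl s x (s ⁻¹) ⟩
          s * s ⁻¹ * x     ≈⟨ *-congʳ (*-inverseʳ s λ s≈0 → proj₂ 0<s (sym s≈0)) ⟩
          1# * x           ≈⟨ *-identityˡ x ⟩
          x                ∎

        0≤b : 0# ≤ b
        0≤b = 0≤* (<⇒≤ ½-pos) (0≤+ 0≤s (0≤* 0≤x (<⇒≤ (⁻¹-pos 0<s))))

        x≤bb : x ≤ b * b
        x≤bb = ≤-by (0≤sq (½ * (s - q))) (begin-equality
          b * b                                           ≈⟨ solve 3 (λ h s q → h :* (s :+ q) :* (h :* (s :+ q)) :=
                                                               (h :+ h) :* (h :+ h) :* (s :* q) :+ h :* (s :- q) :* (h :* (s :- q))) refl ½ s q ⟩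
          (½ + ½) * (½ + ½) * (s * q) + d * d              ≈⟨ +-congʳ (*-cong (*-cong ½+½ ½+½) sq≈x) ⟩
          1# * 1# * x + d * d                              ≈⟨ +-congʳ (*-congʳ (*-identityˡ 1#)) ⟩
          1# * x + d * d                                   ≈⟨ +-congʳ (*-identityˡ x) ⟩
          x + d * d                                        ∎)
          where d = ½ * (s - q)

        s≤b : s ≤ b
        s≤b = proj₂ (proj₂ sup) b λ r (_ , rr≤x) → sq-cancel-≤ 0≤b (≤-trans rr≤x x≤bb)

        s+s≤s+q : s + s ≤ s + q
        s+s≤s+q = begin
          s + s                ≤⟨ +-mono-≤ s≤b s≤b ⟩
          b + b                ≈⟨ distribʳ (s + q) ½ ½ ⟨
          (½ + ½) * (s + q)    ≈⟨ *-congʳ ½+½ ⟩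
          1# * (s + q)         ≈⟨ *-identityˡ _ ⟩
          s + q                ∎

      -- Otherwise s + d w lies in Below, for d = x - s² and w = 1 / (2 s + d + 1).
      x≤ss : x ≤ s * s
      x≤ss = ≮⇒≥ λ ss<x → let
          d     = x - s * s
          0<d   = <⇒0<- ss<x
          m     = (s + s) + d + 1#
          0<m   = <-≤-trans 0<1 (≤-by (0≤+ (0≤+ 0≤s 0≤s) (<⇒≤ 0<d)) (+-comm _ _))
          w     = m ⁻¹
          0<w   = ⁻¹-pos 0<m
          mw≈1  = *-inverseʳ m λ m≈0 → proj₂ 0<m (sym m≈0)
          1≤m   = ≤-by (0≤+ (0≤+ 0≤s 0≤s) (<⇒≤ 0<d)) (+-comm _ _)
          w≤1   = begin
            w            ≈⟨ *-identityʳ w ⟨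
            w * 1#       ≤⟨ *-monoˡ-≤ (<⇒≤ 0<w) 1≤m ⟩
            w * m        ≈⟨ *-comm w m ⟩
            m * w        ≈⟨ mw≈1 ⟩
            1#           ∎
          factor≤m : (s + s) + d * w ≤ m
          factor≤m = begin
            (s + s) + d * w   ≤⟨ +-mono-≤ ≤-refl (*-monoˡ-≤ (<⇒≤ 0<d) w≤1) ⟩
            (s + s) + d * 1#  ≈⟨ +-congˡ (*-identityʳ d) ⟩
            (s + s) + d       ≤⟨ ≤-by (<⇒≤ 0<1) refl ⟩
            m                 ∎
          below = 0≤+ 0≤s (0≤* (<⇒≤ 0<d) (<⇒≤ 0<w)) , (begin
            (s + d * w) * (s + d * w)              ≈⟨ solve 3 (λ s d w → (s :+ d :* w) :* (s :+ d :* w) := s :* s :+ d :* (w :* ((s :+ s) :+ d :* w))) refl s d w ⟩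
            s * s + d * (w * ((s + s) + d * w))    ≤⟨ +-mono-≤ ≤-refl (*-monoˡ-≤ (<⇒≤ 0<d) (*-monoˡ-≤ (<⇒≤ 0<w) factor≤m)) ⟩
            s * s + d * (w * m)                    ≈⟨ +-congˡ (*-congˡ (trans (*-comm w m) mw≈1)) ⟩
            s * s + d * 1#                         ≈⟨ +-congˡ (*-identityʳ d) ⟩
            s * s + d                              ≈⟨ solve 2 (λ s x → s :* s :+ (x :- s :* s) := x) refl s x ⟩
            x                                      ∎)
        in <⇒≱ (<-by (0<* 0<d 0<w) refl) (proj₁ (proj₂ sup) (s + d * w) below)

    sqrt-spec : 0# ≤ sqrt x × sqrt x * sqrt x ≈ x
    sqrt-spec = the-spec (λ r → 0# ≤ r × r * r ≈ x) 0# (s , 0≤s , antisym ss≤x x≤ss)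

-- Real limits, finite sums and Cauchy products

module Limits (em : ExcludedMiddle 0ℓ) (real : CompleteOrderedField) where
  open CompleteOrderedField real using (_<_; supremum; _≤_)
  open OrderedField em real
  open ≤-Reasoning

  Lim : (ℕ → ℝ) → ℝ → Set
  Lim u l = ∀ ε → 0# < ε → ∃ λ N → ∀ n → N ℕ.≤ n → l - ε < u n × u n < l + ε

  -- Otherwise let δ be half of the gap l + c - l′. For large n, v n < l′ + δ = (l - δ) + c ≤ u n +
  -- c ≤ v n.
  lim-+-≤ : ∀ {u v l l′} c N → (∀ n → N ℕ.≤ n → u n + c ≤ v n) → Lim u l → Lim v l′ → l + c ≤ l′
  lim-+-≤ {u} {v} {l} {l′} c N u+c≤v u→l v→l′ = ≮⇒≥ λ l′<l+c → let
      δ , 0<δ , δ+δ≈ = halve (<⇒0<- l′<l+c)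
      N₁ , near₁     = u→l δ 0<δ
      N₂ , near₂     = v→l′ δ 0<δ
      n              = N ℕ.+ (N₁ ℕ.+ N₂)
      N₁≤n           = ℕ.≤-trans (ℕ.m≤m+n N₁ N₂) (ℕ.m≤n+m _ N)
      N₂≤n           = ℕ.≤-trans (ℕ.m≤n+m N₂ N₁) (ℕ.m≤n+m _ N)
    in <⇒≱ (proj₂ (near₂ n N₂≤n)) (begin
      l′ + δ                   ≈⟨ solve 2 (λ k δ → k :+ δ := k :+ (δ :+ δ) :- δ) refl l′ δ ⟩
      l′ + (δ + δ) - δ         ≈⟨ +-congʳ (+-congˡ δ+δ≈) ⟩
      l′ + (l + c - l′) - δ    ≈⟨ solve 4 (λ k l c δ → k :+ (l :+ c :- k) :- δ := (l :- δ) :+ c) refl l′ l c δ ⟩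
      (l - δ) + c              ≤⟨ +-mono-≤ (<⇒≤ (proj₁ (near₁ n N₁≤n))) ≤-refl ⟩
      u n + c                  ≤⟨ u+c≤v n (ℕ.m≤m+n N _) ⟩
      v n                      ∎)

  lim-const : ∀ {u c} → (∀ n → u n ≈ c) → Lim u c
  lim-const {u} {c} u≈c ε 0<ε = 0 , λ n _ →
    <-respʳ-≈ (sym (u≈c n)) (<-by 0<ε (solve 2 (λ c e → c := (c :- e) :+ e) refl c ε)) ,
    <-by 0<ε (+-congʳ (sym (u≈c n)))

  monotone⇒≤ : ∀ {u : ℕ → ℝ} → (∀ n → u n ≤ u (suc n)) → ∀ k n → u n ≤ u (k ℕ.+ n)
  monotone⇒≤ step zero    n = ≤-refl
  monotone⇒≤ step (suc k) n = ≤-trans (monotone⇒≤ step k n) (step (k ℕ.+ n))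

  monotone-convergence : ∀ {u : ℕ → ℝ} {B} → (∀ n → u n ≤ u (suc n)) → (∀ n → u n ≤ B) → ∃ (Lim u)
  monotone-convergence {u} {B} step u≤B = s , conv
    where
    Value : ℝ → Set
    Value y = ∃ λ n → y ≈ u n

    sup = supremum Value (u 0 , 0 , refl) (B , λ y (n , y≈un) → ≤-respˡ-≈ (sym y≈un) (u≤B n))
    s   = proj₁ sup

    conv : Lim u s
    conv ε 0<ε with em {∃ λ N → s - ε < u N}
    ... | yes (N , close) = N , λ n N≤n →
      <-≤-trans close (≡.subst (λ m → u N ≤ u m) (ℕ.m∸n+n≡m N≤n) (monotone⇒≤ {u} step (n ℕ.∸ N) N)) ,
      ≤-<-trans (proj₁ (proj₂ sup) _ (n , refl)) (<-by 0<ε refl)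
    ... | no far = contradiction
      (proj₂ (proj₂ sup) (s - ε) λ y (n , y≈un) → ≤-respˡ-≈ (sym y≈un) (≮⇒≥ λ close → far (n , close)))
      (<⇒≱ (<-by 0<ε (solve 2 (λ c e → c := (c :- e) :+ e) refl s ε)))

  -- The first term is split off, as in `∑` over `Fin`, so that `∑-ofℝ` is a plain induction.
  ∑< : (ℕ → ℝ) → ℕ → ℝ
  ∑< a zero    = 0#
  ∑< a (suc n) = a 0 + ∑< (a ∘ suc) n

  ∑<-last : ∀ a n → ∑< a (suc n) ≈ ∑< a n + a n
  ∑<-last a zero    = +-comm _ _
  ∑<-last a (suc n) = trans (+-congˡ (∑<-last (a ∘ suc) n)) (sym (+-assoc _ _ _))

  ∑<-nonNeg : ∀ {a} → (∀ i → 0# ≤ a i) → ∀ n → 0# ≤ ∑< a n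
  ∑<-nonNeg 0≤a zero    = ≤-refl
  ∑<-nonNeg 0≤a (suc n) = 0≤+ (0≤a 0) (∑<-nonNeg (0≤a ∘ suc) n)

  ∑<-mono : ∀ {a b} → (∀ i → a i ≤ b i) → ∀ n → ∑< a n ≤ ∑< b n
  ∑<-mono a≤b zero    = ≤-refl
  ∑<-mono a≤b (suc n) = +-mono-≤ (a≤b 0) (∑<-mono (a≤b ∘ suc) n)

  ∑<-step : ∀ {a} → (∀ i → 0# ≤ a i) → ∀ n → ∑< a n ≤ ∑< a (suc n)
  ∑<-step {a} 0≤a n = ≤-by (0≤a n) (∑<-last a n)

  ∑<-split : ∀ a j n → ∑< a (j ℕ.+ n) ≈ ∑< a j + ∑< (λ i → a (j ℕ.+ i)) n
  ∑<-split a zero    n = sym (+-identityˡ _)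
  ∑<-split a (suc j) n = trans (+-congˡ (∑<-split (a ∘ suc) j n)) (sym (+-assoc _ _ _))

  -- ∑_{i+j=n} a i * b j
  conv : (ℕ → ℝ) → (ℕ → ℝ) → ℕ → ℝ
  conv a b zero    = a 0 * b 0
  conv a b (suc n) = a 0 * b (suc n) + conv (a ∘ suc) b n

  conv-cong : ∀ {a a′ b b′} → (∀ i → a i ≈ a′ i) → (∀ i → b i ≈ b′ i) → ∀ n → conv a b n ≈ conv a′ b′ n
  conv-cong a≈ b≈ zero    = *-cong (a≈ 0) (b≈ 0)
  conv-cong a≈ b≈ (suc n) = +-cong (*-cong (a≈ 0) (b≈ (suc n))) (conv-cong (a≈ ∘ suc) b≈ n)

  conv-+ʳ : ∀ a b c n → conv a (λ i → b i + c i) n ≈ conv a b n + conv a c n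
  conv-+ʳ a b c zero    = distribˡ _ _ _
  conv-+ʳ a b c (suc n) = trans (+-congˡ (conv-+ʳ (a ∘ suc) b c n))
    (solve 5 (λ a b c p q → a :* (b :+ c) :+ (p :+ q) := (a :* b :+ p) :+ (a :* c :+ q)) refl
      (a 0) (b (suc n)) (c (suc n)) (conv (a ∘ suc) b n) (conv (a ∘ suc) c n))

  conv-*ˡ : ∀ x a b n → conv (λ i → x * a i) b n ≈ x * conv a b n
  conv-*ˡ x a b zero    = *-assoc _ _ _
  conv-*ˡ x a b (suc n) = trans (+-congˡ (conv-*ˡ x (a ∘ suc) b n))
    (solve 4 (λ x a b p → x :* a :* b :+ x :* p := x :* (a :* b :+ p)) refl x (a 0) (b (suc n)) (conv (a ∘ suc) b n))

  conv-*ʳ : ∀ x a b n → conv a (λ i → x * b i) n ≈ x * conv a b n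
  conv-*ʳ x a b zero    = solve 3 (λ x a b → a :* (x :* b) := x :* (a :* b)) refl x (a 0) (b 0)
  conv-*ʳ x a b (suc n) = trans (+-congˡ (conv-*ʳ x (a ∘ suc) b n))
    (solve 4 (λ x a b p → a :* (x :* b) :+ x :* p := x :* (a :* b :+ p)) refl x (a 0) (b (suc n)) (conv (a ∘ suc) b n))

  -- Serves two sequences that start at 0: the weighted terms j · b j, and the partial sums with the
  -- empty sum at index 0.
  conv-init : ∀ a b n → b 0 ≈ 0# → conv a b (suc n) ≈ conv a (b ∘ suc) n
  conv-init a b zero    b₀≈0 = trans (+-congˡ (trans (*-congˡ b₀≈0) (zeroʳ _))) (+-identityʳ _)
  conv-init a b (suc n) b₀≈0 = +-congˡ (conv-init (a ∘ suc) b n b₀≈0)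

  -- The summand with indices i and j is multiplied by f i + g j, which depends on i + j = n alone.
  -- There are three weights because the induction shifts `f` and `h` but leaves `g` in place.
  conv-weights : ∀ (f g h : ℕ → ℝ) → (∀ i j → f i + g j ≈ h (i ℕ.+ j)) → ∀ a b n →
    conv (λ i → f i * a i) b n + conv a (λ j → g j * b j) n ≈ h n * conv a b n
  conv-weights f g h f+g≈h a b zero = begin-equality
    f 0 * a 0 * b 0 + a 0 * (g 0 * b 0)   ≈⟨ solve 4 (λ f g a b → f :* a :* b :+ a :* (g :* b) := (f :+ g) :* (a :* b)) refl (f 0) (g 0) (a 0) (b 0) ⟩
    (f 0 + g 0) * (a 0 * b 0)             ≈⟨ *-congʳ (f+g≈h 0 0) ⟩
    h 0 * (a 0 * b 0)                     ∎
  conv-weights f g h f+g≈h a b (suc n) = begin-equality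
    (f 0 * a 0 * b (suc n) + p) + (a 0 * (g (suc n) * b (suc n)) + q)
      ≈⟨ solve 6 (λ f g a b p q → (f :* a :* b :+ p) :+ (a :* (g :* b) :+ q) := (f :+ g) :* (a :* b) :+ (p :+ q)) refl
           (f 0) (g (suc n)) (a 0) (b (suc n)) p q ⟩
    (f 0 + g (suc n)) * (a 0 * b (suc n)) + (p + q)
      ≈⟨ +-cong (*-congʳ (f+g≈h 0 (suc n))) (conv-weights (f ∘ suc) g (h ∘ suc) (λ i j → f+g≈h (suc i) j) (a ∘ suc) b n) ⟩
    h (suc n) * (a 0 * b (suc n)) + h (suc n) * conv (a ∘ suc) b n
      ≈⟨ distribˡ _ _ _ ⟨
    h (suc n) * conv a b (suc n) ∎
    where
    p = conv (λ i → f (suc i) * a (suc i)) b n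
    q = conv (a ∘ suc) (λ j → g j * b j) n

  conv-≥ : ∀ {a s} c → (∀ i → 0# ≤ a i) → (∀ m → c ≤ s m) → ∀ n → c * ∑< a (suc n) ≤ conv a s n
  conv-≥ {a} {s} c 0≤a c≤s zero = begin
    c * (a 0 + 0#)   ≈⟨ *-congˡ (+-identityʳ _) ⟩
    c * a 0          ≈⟨ *-comm _ _ ⟩
    a 0 * c          ≤⟨ *-monoˡ-≤ (0≤a 0) (c≤s 0) ⟩
    a 0 * s 0        ∎
  conv-≥ {a} {s} c 0≤a c≤s (suc n) = begin
    c * (a 0 + A)                              ≈⟨ distribˡ _ _ _ ⟩
    c * a 0 + c * A                            ≈⟨ +-congʳ (*-comm _ _) ⟩
    a 0 * c + c * A                            ≤⟨ +-mono-≤ (*-monoˡ-≤ (0≤a 0) (c≤s (suc n))) (conv-≥ c (0≤a ∘ suc) c≤s n) ⟩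
    a 0 * s (suc n) + conv (a ∘ suc) s n       ∎
    where A = ∑< (a ∘ suc) (suc n)

  -- Only the last terms, where the index of s is below m₀, lose K.
  conv-eventually-≥ : ∀ {a s c K} m₀ → (∀ i → 0# ≤ a i) → (∀ m → m₀ ℕ.≤ m → c ≤ s m) → (∀ m → c - K ≤ s m) →
    ∀ j → c * ∑< a (suc (j ℕ.+ m₀)) - K * ∑< (λ i → a (j ℕ.+ i)) (suc m₀) ≤ conv a s (j ℕ.+ m₀)
  conv-eventually-≥ {a} {s} {c} {K} m₀ 0≤a c≤s c-K≤s zero = begin
    c * A - K * A     ≈⟨ solve 3 (λ c k a → c :* a :- k :* a := (c :- k) :* a) refl c K A ⟩
    (c - K) * A       ≤⟨ conv-≥ (c - K) 0≤a c-K≤s m₀ ⟩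
    conv a s m₀       ∎
    where A = ∑< a (suc m₀)
  conv-eventually-≥ {a} {s} {c} {K} m₀ 0≤a c≤s c-K≤s (suc j) = begin
    c * (a 0 + A) - T                            ≈⟨ solve 4 (λ c a A T → c :* (a :+ A) :- T := a :* c :+ (c :* A :- T)) refl c (a 0) A T ⟩
    a 0 * c + (c * A - T)                        ≤⟨ +-mono-≤ (*-monoˡ-≤ (0≤a 0) (c≤s (suc (j ℕ.+ m₀)) (ℕ.m≤n+m m₀ (suc j))))
                                                             (conv-eventually-≥ m₀ (0≤a ∘ suc) c≤s c-K≤s j) ⟩
    a 0 * s (suc (j ℕ.+ m₀)) + conv (a ∘ suc) s (j ℕ.+ m₀)  ∎
    where
    A = ∑< (a ∘ suc) (suc (j ℕ.+ m₀))
    T = K * ∑< (λ i → a (suc (j ℕ.+ i))) (suc m₀)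

  -- `K` accumulates the finitely many deficits below `c` that occur before `m₀`. It is kept
  -- strictly positive because `Exp-neg≤1` divides by it.
  eventually-≥⇒≥ : ∀ {s c} m₀ → (∀ m → m₀ ℕ.≤ m → c ≤ s m) → ∃ λ K → 0# < K × (∀ m → c - K ≤ s m)
  eventually-≥⇒≥ {s} {c} zero     c≤s = 1# , 0<1 , λ m → ≤-trans
    (≤-by (<⇒≤ 0<1) (solve 2 (λ c o → c := (c :- o) :+ o) refl c 1#)) (c≤s m ℕ.z≤n)
  eventually-≥⇒≥ {s} {c} (suc m₀) c≤s with eventually-≥⇒≥ {s ∘ suc} {c} m₀ (λ m m₀≤m → c≤s (suc m) (ℕ.s≤s m₀≤m))
  ... | K , 0<K , c-K≤s with total (s 0) c
  ... | inj₁ s₀≤c = K + (c - s 0) , 0<+ 0<K (≤⇒0≤- s₀≤c) , λ where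
    zero    → ≤-by (<⇒≤ 0<K) (solve 3 (λ s c k → s := (c :- (k :+ (c :- s))) :+ k) refl (s 0) c K)
    (suc m) → ≤-trans (≤-by (≤⇒0≤- s₀≤c) (solve 3 (λ s c k → c :- k := (c :- (k :+ (c :- s))) :+ (c :- s)) refl (s 0) c K)) (c-K≤s m)
  ... | inj₂ c≤s₀ = K , 0<K , λ where
    zero    → ≤-trans (≤-by (<⇒≤ 0<K) (solve 2 (λ c o → c := (c :- o) :+ o) refl c K)) c≤s₀
    (suc m) → c-K≤s m

-- The exponential series at real arguments

module ExponentialSeries (em : ExcludedMiddle 0ℓ) (real : CompleteOrderedField) where
  open Selberg em real using (fromℕ)
  open CompleteOrderedField real using (_<_; _≤_; _⁻¹; *-inverseʳ)
  open OrderedField em real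
  open Limits em real
  open RawSemiringDefs (Semiring.rawSemiring semiring) using (_^_)
  open ≤-Reasoning

  *-cancelˡ-≤ : ∀ {c a b} → 0# < c → c * a ≤ c * b → a ≤ b
  *-cancelˡ-≤ {c} {a} {b} 0<c ca≤cb = ≮⇒≥ λ b<a → <⇒≱
    (<-by (0<* 0<c (<⇒0<- b<a)) (solve 3 (λ c a b → c :* a := c :* b :+ c :* (a :- b)) refl c a b)) ca≤cb

  fromℕ-inverse : ∀ n → 0# < fromℕ n → fromℕ n * fromℕ n ⁻¹ ≈ 1#
  fromℕ-inverse n (_ , 0≉n) = *-inverseʳ (fromℕ n) λ n≈0 → 0≉n (sym n≈0)

  fromℕ-!-pos : ∀ n → 0# < fromℕ (n !)
  fromℕ-!-pos n = <-≤-trans (fromℕ-pos 0) (fromℕ-mono-≤ (ℕ.1≤n! n))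

  fromℕ-1 : fromℕ 1 ≈ 1#
  fromℕ-1 = +-identityʳ 1#

  term : ℝ → ℕ → ℝ
  term x n = x ^ n * fromℕ (n !) ⁻¹

  term-zero : ∀ x → term x 0 ≈ 1#
  term-zero x = begin-equality
    1# * fromℕ 1 ⁻¹        ≈⟨ *-congʳ fromℕ-1 ⟨
    fromℕ 1 * fromℕ 1 ⁻¹   ≈⟨ fromℕ-inverse 1 (fromℕ-pos 0) ⟩
    1#                     ∎

  -- The recurrence without division. It yields the halving of the tail in `Exp-total` and the
  -- weighted identities in `conv-term-suc`.
  term-suc : ∀ x n → fromℕ (suc n) * term x (suc n) ≈ x * term x n
  term-suc x n = begin-equality
    a * (x * p * g ⁻¹)                       ≈⟨ *-identityʳ _ ⟨
    a * (x * p * g ⁻¹) * 1#                  ≈⟨ *-congˡ (fromℕ-inverse (n !) (fromℕ-!-pos n)) ⟨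
    a * (x * p * g ⁻¹) * (f * f ⁻¹)          ≈⟨ solve 6 (λ a x p i f j → a :* (x :* p :* i) :* (f :* j) := x :* (p :* j) :* (a :* f :* i)) refl a x p (g ⁻¹) f (f ⁻¹) ⟩
    x * (p * f ⁻¹) * (a * f * g ⁻¹)          ≈⟨ *-congˡ (*-congʳ (fromℕ-* (suc n) (n !))) ⟨
    x * (p * f ⁻¹) * (g * g ⁻¹)              ≈⟨ *-congˡ (fromℕ-inverse (suc n !) (fromℕ-!-pos (suc n))) ⟩
    x * (p * f ⁻¹) * 1#                      ≈⟨ *-identityʳ _ ⟩
    x * (p * f ⁻¹)                           ∎
    where
    a = fromℕ (suc n)
    p = x ^ n
    f = fromℕ (n !)
    g = fromℕ (suc n !)

  term-one : ∀ x → term x 1 ≈ x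
  term-one x = begin-equality
    term x 1             ≈⟨ *-identityˡ _ ⟨
    1# * term x 1        ≈⟨ *-congʳ fromℕ-1 ⟨
    fromℕ 1 * term x 1   ≈⟨ term-suc x 0 ⟩
    x * term x 0         ≈⟨ *-congˡ (term-zero x) ⟩
    x * 1#               ≈⟨ *-identityʳ x ⟩
    x                    ∎

  ^-nonNeg : ∀ {x} → 0# ≤ x → ∀ n → 0# ≤ x ^ n
  ^-nonNeg 0≤x zero    = <⇒≤ 0<1
  ^-nonNeg 0≤x (suc n) = 0≤* 0≤x (^-nonNeg 0≤x n)

  ^-mono : ∀ {x y} → 0# ≤ x → x ≤ y → ∀ n → x ^ n ≤ y ^ n
  ^-mono 0≤x x≤y zero = ≤-refl
  ^-mono {x} {y} 0≤x x≤y (suc n) = begin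
    x * x ^ n   ≤⟨ *-monoˡ-≤ 0≤x (^-mono 0≤x x≤y n) ⟩
    x * y ^ n   ≈⟨ *-comm _ _ ⟩
    y ^ n * x   ≤⟨ *-monoˡ-≤ (^-nonNeg (≤-trans 0≤x x≤y) n) x≤y ⟩
    y ^ n * y   ≈⟨ *-comm _ _ ⟩
    y * y ^ n   ∎

  !⁻¹-nonNeg : ∀ n → 0# ≤ fromℕ (n !) ⁻¹
  !⁻¹-nonNeg n = <⇒≤ (⁻¹-pos (fromℕ-!-pos n))

  term-nonNeg : ∀ {x} → 0# ≤ x → ∀ n → 0# ≤ term x n
  term-nonNeg 0≤x n = 0≤* (^-nonNeg 0≤x n) (!⁻¹-nonNeg n)

  term-mono : ∀ {x y} → 0# ≤ x → x ≤ y → ∀ n → term x n ≤ term y n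
  term-mono {x} {y} 0≤x x≤y n = begin
    x ^ n * fromℕ (n !) ⁻¹   ≈⟨ *-comm _ _ ⟩
    fromℕ (n !) ⁻¹ * x ^ n   ≤⟨ *-monoˡ-≤ (!⁻¹-nonNeg n) (^-mono 0≤x x≤y n) ⟩
    fromℕ (n !) ⁻¹ * y ^ n   ≈⟨ *-comm _ _ ⟩
    y ^ n * fromℕ (n !) ⁻¹   ∎

  -- A relation, because a limit is constructed only for nonnegative arguments; `Exp-neg≤1` takes
  -- the limit at a negative argument as a hypothesis.
  Exp : ℝ → ℝ → Set
  Exp x l = Lim (∑< (term x)) l

  -- Once n ≥ 2 x the terms at least halve, so ∑_{i<n} x^i / i! + 2 x^n / n! decreases.
  Exp-total : ∀ {x} → 0# ≤ x → ∃ (Exp x)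
  Exp-total {x} 0≤x = monotone-convergence (∑<-step 0≤t) λ n → begin
    -- Advancing the index by `N` makes the bound `V N` cover indices below `N` too.
    ∑< t n                 ≤⟨ monotone⇒≤ {∑< t} (∑<-step 0≤t) N n ⟩
    ∑< t (N ℕ.+ n)         ≡⟨ ≡.cong (∑< t) (ℕ.+-comm N n) ⟩
    ∑< t (n ℕ.+ N)         ≤⟨ ≤-by (0≤+ (0≤t (n ℕ.+ N)) (0≤t (n ℕ.+ N))) refl ⟩
    V (n ℕ.+ N)            ≤⟨ V-decreasing n ⟩
    V N                    ∎
    where
    t   = term x
    0≤t = term-nonNeg 0≤x
    N   = proj₁ (archimedean (x + x))

    V : ℕ → ℝ
    V n = ∑< t n + (t n + t n)

    halves : ∀ n → N ℕ.≤ n → t (suc n) + t (suc n) ≤ t n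
    halves n N≤n = *-cancelˡ-≤ (fromℕ-pos n) (begin
      m * (t (suc n) + t (suc n))     ≈⟨ distribˡ _ _ _ ⟩
      m * t (suc n) + m * t (suc n)   ≈⟨ +-cong (term-suc x n) (term-suc x n) ⟩
      x * t n + x * t n               ≈⟨ solve 2 (λ x t → x :* t :+ x :* t := t :* (x :+ x)) refl x (t n) ⟩
      t n * (x + x)                   ≤⟨ *-monoˡ-≤ (0≤t n) (≤-trans (proj₂ (archimedean (x + x))) (fromℕ-mono-≤ (ℕ.m≤n⇒m≤1+n N≤n))) ⟩
      t n * m                         ≈⟨ *-comm _ _ ⟩
      m * t n                         ∎)
      where m = fromℕ (suc n)

    V-decreasing : ∀ k → V (k ℕ.+ N) ≤ V N
    V-decreasing zero    = ≤-refl
    V-decreasing (suc k) = begin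
      ∑< t (suc n) + (t (suc n) + t (suc n))  ≤⟨ +-mono-≤ (≤-reflexive (∑<-last t n)) (halves n (ℕ.m≤n+m N k)) ⟩
      ∑< t n + t n + t n                      ≈⟨ +-assoc _ _ _ ⟩
      V n                                     ≤⟨ V-decreasing k ⟩
      V N                                     ∎
      where n = k ℕ.+ N

  -- The constant terms agree, the linear terms differ by exactly y - x, and all later terms are
  -- monotone. The comparison starts at two terms so that the linear one is present.
  Exp-growth : ∀ {x y l l′} → 0# ≤ x → x ≤ y → Exp x l → Exp y l′ → l + (y - x) ≤ l′
  Exp-growth {x} {y} 0≤x x≤y = lim-+-≤ (y - x) 2 (λ where
    (suc (suc n)) (ℕ.s≤s (ℕ.s≤s _)) → begin
      (term x 0 + (term x 1 + rest x n)) + (y - x)   ≈⟨ +-congʳ (+-cong (term-zero x) (+-congʳ (term-one x))) ⟩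
      (1# + (x + rest x n)) + (y - x)                ≈⟨ solve 4 (λ o x r y → (o :+ (x :+ r)) :+ (y :- x) := o :+ (y :+ r)) refl 1# x (rest x n) y ⟩
      1# + (y + rest x n)                            ≤⟨ +-mono-≤ ≤-refl (+-mono-≤ ≤-refl (∑<-mono (λ i → term-mono 0≤x x≤y (suc (suc i))) n)) ⟩
      1# + (y + rest y n)                            ≈⟨ +-cong (term-zero y) (+-congʳ (term-one y)) ⟨
      term y 0 + (term y 1 + rest y n)               ∎)
    where
    rest : ℝ → ℕ → ℝ
    rest z = ∑< (λ i → term z (suc (suc i)))

  1+x≤Exp : ∀ {x l} → 0# ≤ x → Exp x l → 1# + x ≤ l
  1+x≤Exp {x} 0≤x = lim-+-≤ {λ _ → 1#} x 2
    (λ where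
      (suc (suc n)) (ℕ.s≤s (ℕ.s≤s _)) → begin
        1# + x                                                     ≈⟨ +-cong (term-zero x) (term-one x) ⟨
        term x 0 + term x 1                                        ≤⟨ +-mono-≤ ≤-refl (≤-by (∑<-nonNeg (λ i → term-nonNeg 0≤x (suc (suc i))) n) refl) ⟩
        ∑< (term x) (suc (suc n))                                  ∎)
    (lim-const λ _ → refl)

  -- By the Leibniz rule for the weights i and j,
  -- n ∑_{i+j=n} x^i/i! y^j/j! = (x + y) ∑_{i+j=n-1} x^i/i! y^j/j!.
  conv-term-suc : ∀ {x y} → x + y ≈ 0# → ∀ n → conv (term x) (term y) (suc n) ≈ 0#
  conv-term-suc {x} {y} x+y≈0 n = begin-equality
    c                          ≈⟨ *-identityˡ c ⟨
    1# * c                     ≈⟨ *-congʳ (fromℕ-inverse (suc n) (fromℕ-pos n)) ⟨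
    m * m ⁻¹ * c               ≈⟨ solve 3 (λ m i c → m :* i :* c := i :* (m :* c)) refl m (m ⁻¹) c ⟩
    m ⁻¹ * (m * c)             ≈⟨ *-congˡ mc≈0 ⟩
    m ⁻¹ * 0#                  ≈⟨ zeroʳ _ ⟩
    0#                         ∎
    where
    e = term x
    u = term y
    c = conv e u (suc n)
    m = fromℕ (suc n)

    left : conv (λ i → fromℕ i * e i) u (suc n) ≈ x * conv e u n
    left = begin-equality
      0# * e 0 * u (suc n) + conv (λ i → fromℕ (suc i) * e (suc i)) u n   ≈⟨ +-cong (trans (*-assoc _ _ _) (zeroˡ _)) (conv-cong (term-suc x) (λ _ → refl) n) ⟩
      0# + conv (λ i → x * e i) u n                                       ≈⟨ +-identityˡ _ ⟩
      conv (λ i → x * e i) u n                                            ≈⟨ conv-*ˡ x e u n ⟩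
      x * conv e u n                                                      ∎

    right : conv e (λ j → fromℕ j * u j) (suc n) ≈ y * conv e u n
    right = begin-equality
      conv e (λ j → fromℕ j * u j) (suc n)           ≈⟨ conv-init e (λ j → fromℕ j * u j) n (zeroˡ _) ⟩
      conv e (λ j → fromℕ (suc j) * u (suc j)) n     ≈⟨ conv-cong (λ _ → refl) (term-suc y) n ⟩
      conv e (λ j → y * u j) n                       ≈⟨ conv-*ʳ y e u n ⟩
      y * conv e u n                                 ∎

    mc≈0 : m * c ≈ 0#
    mc≈0 = begin-equality
      m * c                                ≈⟨ conv-weights fromℕ fromℕ fromℕ (λ i j → sym (fromℕ-+ i j)) e u (suc n) ⟨
      _ + _                                ≈⟨ +-cong left right ⟩
      x * conv e u n + y * conv e u n      ≈⟨ distribʳ _ _ _ ⟨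
      (x + y) * conv e u n                 ≈⟨ *-congʳ x+y≈0 ⟩
      0# * conv e u n                      ≈⟨ zeroˡ _ ⟩
      0#                                   ∎

  -- The left side is the sum of the Cauchy product of the two series over degrees 0 to n, and by
  -- `conv-term-suc` only degree 0 contributes. This is the finite form of exp x · exp (-x) = 1.
  conv-term-∑< : ∀ {x y} → x + y ≈ 0# → ∀ n → conv (term x) (λ m → ∑< (term y) (suc m)) n ≈ 1#
  conv-term-∑< {x} {y} x+y≈0 zero = begin-equality
    term x 0 * (term y 0 + 0#)   ≈⟨ *-cong (term-zero x) (trans (+-identityʳ _) (term-zero y)) ⟩
    1# * 1#                      ≈⟨ *-identityˡ 1# ⟩
    1#                           ∎
  conv-term-∑< {x} {y} x+y≈0 (suc n) = begin-equality
    conv e (S ∘ suc) (suc n)                    ≈⟨ conv-cong {e} (λ _ → refl) (∑<-last u) (suc n) ⟩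
    conv e (λ m → S m + u m) (suc n)            ≈⟨ conv-+ʳ e S u (suc n) ⟩
    conv e S (suc n) + conv e u (suc n)         ≈⟨ +-cong (conv-init e S n refl) (conv-term-suc x+y≈0 n) ⟩
    conv e (S ∘ suc) n + 0#                     ≈⟨ +-identityʳ _ ⟩
    conv e (S ∘ suc) n                          ≈⟨ conv-term-∑< x+y≈0 n ⟩
    1#                                          ∎
    where
    e = term x
    u = term y
    S = ∑< u

  -- If the limit were 1 + 2 δ, the convolution of the previous lemma would
  -- eventually be at least (1 + δ) ∑_{i≤n} x^i/i! - δ/2 > 1.
  Exp-neg≤1 : ∀ {x y l} → 0# ≤ x → x + y ≈ 0# → Exp y l → l ≤ 1#
  Exp-neg≤1 {x} {y} {l} 0≤x x+y≈0 y→l = ≮⇒≥ λ 1<l → let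
      δ , 0<δ , δ+δ≈     = halve (<⇒0<- 1<l)
      γ , 0<γ , γ+γ≈     = halve 0<δ
      c                  = l - δ
      m₀ , near          = y→l δ 0<δ
      c≤s                = λ m m₀≤m → <⇒≤ (proj₁ (near (suc m) (ℕ.m≤n⇒m≤1+n m₀≤m)))
      K , 0<K , c-K≤s    = eventually-≥⇒≥ {λ m → ∑< (term y) (suc m)} {c} m₀ c≤s
      E , x→E            = Exp-total 0≤x
      -- Chosen so that K (η + η) = γ. The block `T` is a difference of two partial sums, each
      -- within η of `E`, so subtracting K T costs at most γ, half of the surplus δ.
      η , 0<η , η+η≈     = halve (0<* 0<γ (⁻¹-pos 0<K))
      j , close          = x→E η 0<η
      A                  = ∑< e (suc (j ℕ.+ m₀))
      T                  = ∑< (λ i → e (j ℕ.+ i)) (suc m₀)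
      1≤A                = ≤-trans (≤-reflexive (sym (term-zero x))) (≤-by (∑<-nonNeg {e ∘ suc} (0≤e ∘ suc) (j ℕ.+ m₀)) refl)
      T≤η+η              = begin
        T                                     ≈⟨ solve 2 (λ s t → t := (s :+ t) :- s) refl (∑< e j) T ⟩
        (∑< e j + T) - ∑< e j                 ≈⟨ +-congʳ (∑<-split e j (suc m₀)) ⟨
        ∑< e (j ℕ.+ suc m₀) - ∑< e j          ≤⟨ +-mono-≤ (<⇒≤ (proj₂ (close (j ℕ.+ suc m₀) (ℕ.m≤m+n j _))))
                                                          (neg-mono-≤ (<⇒≤ (proj₁ (close j ℕ.≤-refl)))) ⟩
        (E + η) - (E - η)                     ≈⟨ solve 2 (λ e h → (e :+ h) :- (e :- h) := h :+ h) refl E η ⟩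
        η + η                                 ∎
      KT≤γ               = begin
        K * T                ≤⟨ *-monoˡ-≤ (<⇒≤ 0<K) T≤η+η ⟩
        K * (η + η)          ≈⟨ *-congˡ η+η≈ ⟩
        K * (γ * K ⁻¹)       ≈⟨ solve 3 (λ k d i → k :* (d :* i) := k :* i :* d) refl K γ (K ⁻¹) ⟩
        K * K ⁻¹ * γ         ≈⟨ *-congʳ (*-inverseʳ K λ K≈0 → proj₂ 0<K (sym K≈0)) ⟩
        1# * γ               ≈⟨ *-identityˡ γ ⟩
        γ                    ∎
      c≈1+δ              = begin-equality
        l - δ                ≈⟨ solve 3 (λ l d o → l :- d := (o :+ (l :- o)) :- d) refl l δ 1# ⟩
        (1# + (l - 1#)) - δ  ≈⟨ +-congʳ (+-congˡ δ+δ≈) ⟨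
        (1# + (δ + δ)) - δ   ≈⟨ solve 2 (λ d o → (o :+ (d :+ d)) :- d := o :+ d) refl δ 1# ⟩
        1# + δ               ∎
      0≤c                = ≤-trans (0≤+ (<⇒≤ 0<1) (<⇒≤ 0<δ)) (≤-reflexive (sym c≈1+δ))
    in <⇒≱ (<-by 0<γ refl) (begin
      1# + γ                                            ≈⟨ solve 2 (λ o g → o :+ g := (o :+ (g :+ g)) :- g) refl 1# γ ⟩
      (1# + (γ + γ)) - γ                                ≈⟨ +-congʳ (trans (+-congˡ γ+γ≈) (sym c≈1+δ)) ⟩
      c - γ                                             ≈⟨ +-congʳ (*-identityʳ c) ⟨
      c * 1# - γ                                        ≤⟨ +-mono-≤ (*-monoˡ-≤ 0≤c 1≤A) (neg-mono-≤ KT≤γ) ⟩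
      c * A - K * T                                     ≤⟨ conv-eventually-≥ {a = e} m₀ 0≤e c≤s c-K≤s j ⟩
      conv e (λ m → ∑< (term y) (suc m)) (j ℕ.+ m₀)     ≈⟨ conv-term-∑< x+y≈0 (j ℕ.+ m₀) ⟩
      1#                                                ∎)
    where
    e   = term x
    0≤e = term-nonNeg 0≤x

-- The complex exponential on the real line and its inverse

module Logarithm (em : ExcludedMiddle 0ℓ) (real : CompleteOrderedField) where
  open Selberg em real
  open CompleteOrderedField real using (_<_; _≤_; _⁻¹; *-inverseʳ)
  open OrderedField em real
  open SquareRoot em real
  open Limits em real
  open ExponentialSeries em real
  open RawSemiringDefs (Semiring.rawSemiring semiring) using (_^_)
  open ≤-Reasoning

  ∣∣²-nonNeg : ∀ z → 0# ≤ ∣ z ∣²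
  ∣∣²-nonNeg z = 0≤+ (0≤sq (Re z)) (0≤sq (Im z))

  ReRe≤∣∣∣∣ : ∀ z → Re z * Re z ≤ ∣ z ∣ * ∣ z ∣
  ReRe≤∣∣∣∣ z = ≤-respʳ-≈ (sym (proj₂ (sqrt-spec (∣∣²-nonNeg z)))) (≤-by (0≤sq (Im z)) refl)

  Re≤∣∣ : ∀ z → Re z ≤ ∣ z ∣
  Re≤∣∣ z = sq-cancel-≤ (proj₁ (sqrt-spec (∣∣²-nonNeg z))) (ReRe≤∣∣∣∣ z)

  -Re≤∣∣ : ∀ z → - Re z ≤ ∣ z ∣
  -Re≤∣∣ z = sq-cancel-≤ (proj₁ (sqrt-spec (∣∣²-nonNeg z)))
    (≤-respˡ-≈ (solve 1 (λ a → a :* a := (:- a) :* (:- a)) refl (Re z)) (ReRe≤∣∣∣∣ z))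

  ∣∣< : ∀ {z ε} → Im z ≈ 0# → 0# < ε → - ε < Re z → Re z < ε → ∣ z ∣ < ε
  ∣∣< {z} {ε} Im≈0 0<ε -ε<Re Re<ε = sq-cancel-< (proj₁ spec) (<⇒≤ 0<ε)
    (<-by (0<* (<⇒0<- -ε<Re) (<⇒0<- Re<ε)) (begin-equality
      ε * ε                                                              ≈⟨ solve 2 (λ e r → e :* e := r :* r :+ (r :- (:- e)) :* (e :- r)) refl ε (Re z) ⟩
      Re z * Re z + (Re z - - ε) * (ε - Re z)                            ≈⟨ +-congʳ Re²≈ ⟩
      ∣ z ∣ * ∣ z ∣ + (Re z - - ε) * (ε - Re z)                          ∎))
    where
    spec = sqrt-spec (∣∣²-nonNeg z)

    Re²≈ : Re z * Re z ≈ ∣ z ∣ * ∣ z ∣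
    Re²≈ = begin-equality
      Re z * Re z                  ≈⟨ +-identityʳ _ ⟨
      Re z * Re z + 0#             ≈⟨ +-congˡ (trans (*-congʳ Im≈0) (zeroˡ _)) ⟨
      Re z * Re z + Im z * Im z    ≈⟨ proj₂ spec ⟨
      ∣ z ∣ * ∣ z ∣                ∎

  ofℝ-^ : ∀ x n → ofℝ x ^ᶜ n ≈ᶜ ofℝ (x ^ n)
  ofℝ-^ x zero    = refl , refl
  ofℝ-^ x (suc n) =
    (begin-equality
      x * Re p - 0# * Im p    ≈⟨ solve 3 (λ x r i → x :* r :- con (+ 0) :* i := x :* r) refl x (Re p) (Im p) ⟩
      x * Re p                ≈⟨ *-congˡ (proj₁ (ofℝ-^ x n)) ⟩
      x * x ^ n               ∎) ,
    (begin-equality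
      x * Im p + 0# * Re p    ≈⟨ +-congʳ (*-congˡ (proj₂ (ofℝ-^ x n))) ⟩
      x * 0# + 0# * Re p      ≈⟨ solve 2 (λ x r → x :* con (+ 0) :+ con (+ 0) :* r := con (+ 0)) refl x (Re p) ⟩
      0#                      ∎)
    where p = ofℝ x ^ᶜ n

  ofℝ-⁻¹ : ∀ {x} → 0# < x → ofℝ x ⁻¹ᶜ ≈ᶜ ofℝ (x ⁻¹)
  ofℝ-⁻¹ {x} 0<x@(_ , 0≉x) =
    (begin-equality
      x * J - - 0# * 0#        ≈⟨ solve 2 (λ x j → x :* j :- (:- con (+ 0)) :* con (+ 0) := x :* j) refl x J ⟩
      x * J                    ≈⟨ *-identityʳ _ ⟨
      -- The inserted x · x⁻¹ supplies the second factor x, completing `m` = x · x + 0 · 0 for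
      -- cancellation against `J`.
      x * J * 1#               ≈⟨ *-congˡ (*-inverseʳ x λ x≈0 → 0≉x (sym x≈0)) ⟨
      x * J * (x * x ⁻¹)       ≈⟨ solve 3 (λ x j i → x :* j :* (x :* i) := (x :* x :+ con (+ 0) :* con (+ 0)) :* j :* i) refl x J (x ⁻¹) ⟩
      m * J * x ⁻¹             ≈⟨ *-congʳ (*-inverseʳ m λ m≈0 → proj₂ 0<m (sym m≈0)) ⟩
      1# * x ⁻¹                ≈⟨ *-identityˡ _ ⟩
      x ⁻¹                     ∎) ,
    solve 2 (λ x j → x :* con (+ 0) :+ (:- con (+ 0)) :* j := con (+ 0)) refl x J
    where
    m = ∣ ofℝ x ∣²
    J = m ⁻¹
    0<m = 0<+ (0<* 0<x 0<x) (0≤sq 0#)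

  *ᶜ-cong : ∀ {z z′ w w′} → z ≈ᶜ z′ → w ≈ᶜ w′ → z *ᶜ w ≈ᶜ z′ *ᶜ w′
  *ᶜ-cong (a , b) (c , d) =
    +-cong (*-cong a c) (-‿cong (*-cong b d)) , +-cong (*-cong a d) (*-cong b c)

  expTerm : ℝ → ℕ → ℂ
  expTerm x i = ofℝ x ^ᶜ i *ᶜ natᶜ (i !) ⁻¹ᶜ

  expTerm≈ : ∀ x i → expTerm x i ≈ᶜ ofℝ (term x i)
  expTerm≈ x i = trans (proj₁ lhs) (solve 2 (λ p q → p :* q :- con (+ 0) :* con (+ 0) := p :* q) refl (x ^ i) (fromℕ (i !) ⁻¹)) ,
    trans (proj₂ lhs) (solve 2 (λ p q → p :* con (+ 0) :+ con (+ 0) :* q := con (+ 0)) refl (x ^ i) (fromℕ (i !) ⁻¹))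
    where lhs = *ᶜ-cong (ofℝ-^ x i) (ofℝ-⁻¹ (fromℕ-!-pos i))

  ∑-ofℝ : ∀ (f : ℕ → ℂ) (a : ℕ → ℝ) → (∀ i → f i ≈ᶜ ofℝ (a i)) → ∀ n → (∑ {n} λ i → f (toℕ i)) ≈ᶜ ofℝ (∑< a n)
  ∑-ofℝ f a f≈a zero    = refl , refl
  ∑-ofℝ f a f≈a (suc n) = +-cong (proj₁ (f≈a 0)) (proj₁ rest) ,
    trans (+-cong (proj₂ (f≈a 0)) (proj₂ rest)) (+-identityˡ 0#)
    where rest = ∑-ofℝ (f ∘ suc) (a ∘ suc) (f≈a ∘ suc) n

  expSum : ℝ → ℕ → ℂ
  expSum x N = ∑ {N} λ i → expTerm x (toℕ i)

  Converges⇒Exp : ∀ {x l} → Converges (expSum x) l → Exp x (Re l)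
  Converges⇒Exp {x} {l} c ε 0<ε with c ε 0<ε
  ... | N , near = N , λ n N≤n → let
      d     = expSum x n -ᶜ l
      Re≈   = proj₁ (∑-ofℝ (expTerm x) (term x) (expTerm≈ x) n)
      lower = ≤-<-trans (-Re≤∣∣ d) (near n N≤n)
      upper = ≤-<-trans (Re≤∣∣ d) (near n N≤n)
    in <-by (<⇒0<- lower) (trans (sym Re≈)
         (solve 3 (λ s l e → s := (l :- e) :+ (e :- (:- (s :- l)))) refl (Re (expSum x n)) (Re l) ε)) ,
       ≤-<-trans (≤-reflexive (sym Re≈)) (<-by (<⇒0<- upper)
         (solve 3 (λ s l e → l :+ e := s :+ (e :- (s :- l))) refl (Re (expSum x n)) (Re l) ε))

  Exp⇒Converges : ∀ {x l} → Exp x l → Converges (expSum x) (ofℝ l)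
  Exp⇒Converges {x} {l} x→l ε 0<ε with x→l ε 0<ε
  ... | N , near = N , λ n N≤n → let
      Re≈ , Im≈     = ∑-ofℝ (expTerm x) (term x) (expTerm≈ x) n
      lower , upper = near n N≤n
      R             = Re (expSum x n)
    in ∣∣< (trans (+-congʳ Im≈) (-‿inverseʳ 0#)) 0<ε
         (<-by (<⇒0<- lower) (trans (+-congʳ Re≈)
           (solve 3 (λ s l e → s :- l := (:- e) :+ (s :- (l :- e))) refl (∑< (term x) n) l ε)))
         (<-by (<⇒0<- upper) (trans (solve 3 (λ s l e → e := (s :- l) :+ ((l :+ e) :- s)) refl (∑< (term x) n) l ε)
           (+-congʳ (+-congʳ (sym Re≈)))))

  exp-spec : ∀ {x} → 0# ≤ x → Exp x (exp x)
  exp-spec {x} 0≤x = Converges⇒Exp (the-spec (Converges (expSum x)) 0ᶜ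
    (_ , Exp⇒Converges (proj₂ (Exp-total 0≤x))))

  -- The second case is the junk value of a divergent series; leaving it open
  -- saves the proof of convergence at negative arguments.
  exp-spec? : ∀ x → Exp x (exp x) ⊎ exp x ≈ 0#
  exp-spec? x with the-spec? (Converges (expSum x)) 0ᶜ
  ... | inj₁ c  = inj₁ (Converges⇒Exp c)
  ... | inj₂ eq = inj₂ (reflexive (≡.cong Re eq))

  1+x≤exp : ∀ {x} → 0# ≤ x → 1# + x ≤ exp x
  1+x≤exp 0≤x = 1+x≤Exp 0≤x (exp-spec 0≤x)

  -- For y > 0 the value exp y is at least 1 + y > 1. The default value 0 and, by `Exp-neg≤1`, every
  -- limit at a negative argument are at most 1, which forces x ≥ 0. There `Exp-growth` makes exp
  -- strictly increasing.
  exp-injective : ∀ {x y} → 0# < y → exp x ≈ exp y → x ≈ y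
  exp-injective {x} {y} 0<y eˣ≈eʸ with exp-spec? x
  ... | inj₂ eˣ≈0 = contradiction (≤-trans (1+x≤exp (<⇒≤ 0<y)) (≤-reflexive (trans (sym eˣ≈eʸ) eˣ≈0)))
                      (<⇒≱ (0<+ 0<1 (<⇒≤ 0<y)))
  ... | inj₁ x→eˣ with <-≤-connex x 0#
  ... | inj₁ x<0 = contradiction
    (≤-trans (1+x≤exp (<⇒≤ 0<y)) (≤-trans (≤-reflexive (sym eˣ≈eʸ))
      (Exp-neg≤1 (≤⇒0≤- (<⇒≤ x<0)) (solve 1 (λ x → con (+ 0) :- x :+ x := con (+ 0)) refl x) x→eˣ)))
    (<⇒≱ (<-by 0<y refl))
  ... | inj₂ 0≤x = antisym (≮⇒≥ (distinct (<⇒≤ 0<y) (exp-spec (<⇒≤ 0<y)) x→eˣ (sym eˣ≈eʸ)))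
                           (≮⇒≥ (distinct 0≤x x→eˣ (exp-spec (<⇒≤ 0<y)) eˣ≈eʸ))
    where
    distinct : ∀ {u v l l′} → 0# ≤ u → Exp u l → Exp v l′ → l ≈ l′ → ¬ u < v
    distinct 0≤u u→l v→l′ l≈l′ u<v = <⇒≱ (<-by (<⇒0<- u<v) refl)
      (≤-trans (Exp-growth 0≤u (<⇒≤ u<v) u→l v→l′) (≤-reflexive (sym l≈l′)))

  -- `log x` describes some preimage of `x`; `y` witnesses that one exists, and `exp-injective`
  -- identifies the two.
  log-unique : ∀ {x y} → 0# < y → exp y ≈ x → log x ≈ y
  log-unique {x} {y} 0<y eʸ≈x = exp-injective 0<y
    (trans (the-spec (λ y → exp y ≈ x) 0# (y , eʸ≈x)) (sym eʸ≈x))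

  -- The hypothesis of `log-unique` is an equation up to `≈`, so the outer step takes the inner
  -- identity log (exp (exp y)) ≈ exp y directly.
  loglog-exp-exp : ∀ {y} → 0# < y → log (log (exp (exp y))) ≈ y
  loglog-exp-exp {y} 0<y = log-unique 0<y (sym (log-unique (<-≤-trans (0<+ 0<1 (<⇒≤ 0<y)) (1+x≤exp (<⇒≤ 0<y))) refl))

  x≤exp : ∀ {x} → 0# ≤ x → x ≤ exp x
  x≤exp 0≤x = ≤-trans (≤-by (<⇒≤ 0<1) (+-comm _ _)) (1+x≤exp 0≤x)

-- With values in ℕ, the sums over exponents are evaluated by `sum-kronecker` before `fromℕ` is
-- applied. With `does`, the value at `suc i` and `suc j` computes to the value at `i` and `j`, as
-- the induction there requires.
kronecker : ∀ {k} → Fin k → Fin k → ℕ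
kronecker i j = if does (i Fin.≟ j) then 1 else 0

sum-kronecker : ∀ {k} (e : Fin k → ℕ) i → sum (λ j → e j ℕ.* kronecker j i) ≡ e i
sum-kronecker e zero = ≡.trans (≡.cong₂ ℕ._+_ (ℕ.*-identityʳ (e zero)) (vanish (e ∘ suc))) (ℕ.+-identityʳ (e zero))
  where
  vanish : ∀ {k} (e : Fin k → ℕ) → sum (λ j → e j ℕ.* 0) ≡ 0
  vanish {zero}  e = ≡.refl
  vanish {suc k} e = ≡.cong₂ ℕ._+_ (ℕ.*-zeroʳ (e zero)) (vanish (e ∘ suc))
sum-kronecker e (suc i) = ≡.cong₂ ℕ._+_ (ℕ.*-zeroʳ (e zero)) (sum-kronecker (e ∘ suc) i)

-- Real functions that are O(1)

module Boundedness (em : ExcludedMiddle 0ℓ) (real : CompleteOrderedField) where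
  open Selberg em real
  open CompleteOrderedField real using (_≤_)
  open OrderedField em real
  open Logarithm em real
  open ≤-Reasoning

  Bounded : (ℝ → ℝ) → Set
  Bounded f = ∃₂ λ C x₀ → ∀ x → x₀ ≤ x → - C ≤ f x × f x ≤ C

  IsO1⇒Bounded-Re : ∀ {f} → IsO1 f → Bounded (Re ∘ f)
  IsO1⇒Bounded-Re {f} (C , x₀ , ∣f∣≤C) = C , x₀ , λ x x₀≤x →
    ≤-respʳ-≈ (solve 1 (λ r → :- :- r := r) refl (Re (f x)))
      (neg-mono-≤ (≤-trans (-Re≤∣∣ (f x)) (∣f∣≤C x x₀≤x))) ,
    ≤-trans (Re≤∣∣ (f x)) (∣f∣≤C x x₀≤x)

  Bounded-cong : ∀ {f g} → (∀ x → f x ≈ g x) → Bounded f → Bounded g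
  Bounded-cong f≈g (C , x₀ , bound) = C , x₀ , λ x x₀≤x →
    ≤-respʳ-≈ (f≈g x) (proj₁ (bound x x₀≤x)) , ≤-respˡ-≈ (f≈g x) (proj₂ (bound x x₀≤x))

  upperBound : ∀ a b → ∃ λ c → a ≤ c × b ≤ c
  upperBound a b with total a b
  ... | inj₁ a≤b = b , a≤b , ≤-refl
  ... | inj₂ b≤a = a , ≤-refl , b≤a

  Bounded-+ : ∀ {f g} → Bounded f → Bounded g → Bounded (λ x → f x + g x)
  Bounded-+ (C , x₀ , boundᶠ) (D , x₁ , boundᵍ) with upperBound x₀ x₁
  ... | x₂ , x₀≤x₂ , x₁≤x₂ = C + D , x₂ , λ x x₂≤x → let
      lᶠ , uᶠ = boundᶠ x (≤-trans x₀≤x₂ x₂≤x)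
      lᵍ , uᵍ = boundᵍ x (≤-trans x₁≤x₂ x₂≤x)
    in ≤-respˡ-≈ (solve 2 (λ c d → :- c :- d := :- (c :+ d)) refl C D) (+-mono-≤ lᶠ lᵍ) ,
       +-mono-≤ uᶠ uᵍ

-- Functions equal to c L + O(1), and uniqueness of the integer c

module Asymptotics (em : ExcludedMiddle 0ℓ) (real : CompleteOrderedField)
                   (L : CompleteOrderedField.Carrier real → CompleteOrderedField.Carrier real) where
  open Selberg em real using (fromℕ; fromℤ)
  open CompleteOrderedField real using (_<_; _≤_)
  open OrderedField em real
  open Boundedness em real
  open ≤-Reasoning

  infix 4 _∼_
  _∼_ : (ℝ → ℝ) → ℝ → Set
  f ∼ c = Bounded λ x → f x - c * L x

  ∼-cong : ∀ {f g c d} → (∀ x → f x ≈ g x) → c ≈ d → f ∼ c → g ∼ d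
  ∼-cong f≈g c≈d = Bounded-cong λ x → +-cong (f≈g x) (-‿cong (*-congʳ c≈d))

  ∼-0 : (λ _ → 0#) ∼ 0#
  ∼-0 = 0# , 0# , λ x _ →
    ≤-reflexive (solve 1 (λ l → :- con (+ 0) := con (+ 0) :- con (+ 0) :* l) refl (L x)) ,
    ≤-reflexive (solve 1 (λ l → con (+ 0) :- con (+ 0) :* l := con (+ 0)) refl (L x))

  ∼-+ : ∀ {f g c d} → f ∼ c → g ∼ d → (λ x → f x + g x) ∼ c + d
  ∼-+ {f} {g} {c} {d} f∼c g∼d = Bounded-cong
    (λ x → solve 5 (λ f g c d l → (f :- c :* l) :+ (g :- d :* l) := (f :+ g) :- (c :+ d) :* l) refl
             (f x) (g x) c d (L x))
    (Bounded-+ f∼c g∼d)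

  kronecker-∼ : ∀ {k} (f : Fin k → Fin k → ℝ → ℝ) → (∀ i → f i i ∼ fromℕ 1) → (∀ i j → i ≢ j → f i j ∼ fromℕ 0) →
    ∀ i j → f i j ∼ fromℕ (kronecker i j)
  kronecker-∼ f diagonal off i j with i Fin.≟ j
  ... | yes ≡.refl = diagonal i
  ... | no  i≢j    = off i j i≢j

  -- Every positive M is to be attained exactly, at a point x ≥ M. A single choice of M then both
  -- exceeds a given bound and passes the thresholds hidden in O(1).
  Unbounded : Set
  Unbounded = ∀ M → 0# < M → ∃ λ x → M ≤ x × L x ≈ M

  -- Subtracting the two estimates gives (d - c) L x ≤ C + D for large x. As d - c ≥ 1, this bounds
  -- the positive values of L.
  ∼-separated : Unbounded → ∀ {f c d} → f ∼ c → f ∼ d → ¬ c + 1# ≤ d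
  ∼-separated unbounded {f} {c} {d} (C , x₀ , boundᶜ) (D , x₁ , boundᵈ) c+1≤d
    with upperBound x₀ x₁
  ... | x₂ , x₀≤x₂ , x₁≤x₂ with upperBound x₂ (C + D)
  ... | y , x₂≤y , C+D≤y with archimedean y
  ... | n , y≤n = <⇒≱ (<-by 0<1 (+-comm _ _)) (begin
    M                            ≤⟨ ≤-by (0≤* (<⇒≤ 0<M) (≤⇒0≤- c+1≤d)) (begin-equality
      (d - c) * M                ≈⟨ solve 4 (λ c d o m → (d :- c) :* m := o :* m :+ m :* (d :- (c :+ o))) refl c d 1# M ⟩
      1# * M + M * (d - (c + 1#)) ≈⟨ +-congʳ (*-identityˡ M) ⟩
      M + M * (d - (c + 1#))     ∎) ⟩
    (d - c) * M                  ≈⟨ *-congˡ Lx≈M ⟨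
    (d - c) * L x                ≈⟨ solve 4 (λ f c d l → (d :- c) :* l := (f :- c :* l) :- (f :- d :* l)) refl (f x) c d (L x) ⟩
    (f x - c * L x) - (f x - d * L x) ≤⟨ +-mono-≤ (proj₂ (boundᶜ x (≤-trans x₀≤x₂ x₂≤x))) (neg-mono-≤ (proj₁ (boundᵈ x (≤-trans x₁≤x₂ x₂≤x)))) ⟩
    C - - D                      ≈⟨ solve 2 (λ c d → c :- (:- d) := c :+ d) refl C D ⟩
    C + D                        ≤⟨ C+D≤y ⟩
    y                            ≤⟨ y≤n ⟩
    fromℕ n                      ∎)
    where
    -- `fromℕ n` dominates both thresholds and C + D; the successor makes the contradiction M ≤
    -- `fromℕ n` strict.
    M   = fromℕ (suc n)
    0<M = fromℕ-pos n
    found = unbounded M 0<M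
    x     = proj₁ found
    Lx≈M  = proj₂ (proj₂ found)

    x₂≤x : x₂ ≤ x
    x₂≤x = begin
      x₂        ≤⟨ x₂≤y ⟩
      y         ≤⟨ y≤n ⟩
      fromℕ n   ≤⟨ fromℕ-mono-≤ (ℕ.n≤1+n n) ⟩
      M         ≤⟨ proj₁ (proj₂ found) ⟩
      x         ∎

  -- Unequal integers are at least 1 apart, against `∼-separated`. The integer supplied by (A)
  -- carries no sign information, so a negative one is refuted separately, from -(n + 1) + 1 = -n ≤
  -- 0 ≤ m.
  ∼-unique : Unbounded → ∀ {f} n m → f ∼ fromℤ n → f ∼ fromℕ m → n ≡ + m
  ∼-unique unb (+ n) m f∼n f∼m with ℕ.<-cmp n m
  ... | tri< n<m _ _ = contradiction (≤-trans (≤-reflexive (+-comm _ _)) (fromℕ-mono-≤ n<m)) (∼-separated unb f∼n f∼m)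
  ... | tri≈ _ n≡m _ = ≡.cong +_ n≡m
  ... | tri> _ _ n>m = contradiction (≤-trans (≤-reflexive (+-comm _ _)) (fromℕ-mono-≤ n>m)) (∼-separated unb f∼m f∼n)
  ∼-unique unb -[1+ n ] m f∼n f∼m = contradiction
    (≤-trans (≤-by (fromℕ-nonNeg n) (solve 2 (λ o n → con (+ 0) := (:- (o :+ n) :+ o) :+ n) refl 1# (fromℕ n))) (fromℕ-nonNeg m))
    (∼-separated unb f∼n f∼m)

-- Coefficients of Dirichlet products at primes

module PrimeCoefficients (em : ExcludedMiddle 0ℓ) (real : CompleteOrderedField) where
  open Selberg em real
  open OrderedField em real
  open Logarithm em real using (*ᶜ-cong)
  open RawSemiringDefs (RawRing.rawSemiring ℂ-rawRing) public using () renaming (_×_ to _×ᶜ_)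

  ≈ᶜ-refl : ∀ {z} → z ≈ᶜ z
  ≈ᶜ-refl = refl , refl

  ≈ᶜ-trans : ∀ {z w v} → z ≈ᶜ w → w ≈ᶜ v → z ≈ᶜ v
  ≈ᶜ-trans (a , b) (c , d) = trans a c , trans b d

  ≈ᶜ-reflexive : ∀ {z w} → z ≡ w → z ≈ᶜ w
  ≈ᶜ-reflexive ≡.refl = ≈ᶜ-refl

  +ᶜ-cong : ∀ {z z′ w w′} → z ≈ᶜ z′ → w ≈ᶜ w′ → z +ᶜ w ≈ᶜ z′ +ᶜ w′
  +ᶜ-cong (a , b) (c , d) = +-cong a c , +-cong b d

  +ᶜ-identityˡ : ∀ z → 0ᶜ +ᶜ z ≈ᶜ z
  +ᶜ-identityˡ z = +-identityˡ _ , +-identityˡ _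

  +ᶜ-identityʳ : ∀ z → z +ᶜ 0ᶜ ≈ᶜ z
  +ᶜ-identityʳ z = +-identityʳ _ , +-identityʳ _

  +ᶜ-comm : ∀ z w → z +ᶜ w ≈ᶜ w +ᶜ z
  +ᶜ-comm z w = +-comm _ _ , +-comm _ _

  *ᶜ-identityˡ : ∀ z → 1ᶜ *ᶜ z ≈ᶜ z
  *ᶜ-identityˡ (x +i y) =
    trans (solve 3 (λ o x y → o :* x :- con (+ 0) :* y := o :* x) refl 1# x y) (*-identityˡ x) ,
    trans (solve 3 (λ o x y → o :* y :+ con (+ 0) :* x := o :* y) refl 1# x y) (*-identityˡ y)

  *ᶜ-identityʳ : ∀ z → z *ᶜ 1ᶜ ≈ᶜ z
  *ᶜ-identityʳ (x +i y) =
    trans (solve 3 (λ o x y → x :* o :- y :* con (+ 0) := o :* x) refl 1# x y) (*-identityˡ x) ,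
    trans (solve 3 (λ o x y → x :* con (+ 0) :+ y :* o := o :* y) refl 1# x y) (*-identityˡ y)

  Normalised : DirichletSeries → Set
  Normalised a = a 1 ≈ᶜ 1ᶜ

  ∑-last : ∀ n (h : ℕ → ℂ) → (∀ i → i ℕ.< n → h i ≈ᶜ 0ᶜ) → (∑ {suc n} λ i → h (toℕ i)) ≈ᶜ h n
  ∑-last zero    h h≈0 = +ᶜ-identityʳ _
  ∑-last (suc n) h h≈0 = ≈ᶜ-trans
    (+ᶜ-cong (h≈0 0 ℕ.z<s) (∑-last n (h ∘ suc) λ i i<n → h≈0 (suc i) (ℕ.s<s i<n)))
    (+ᶜ-identityˡ _)

  *ᴰ-normalised : ∀ {a b} → Normalised a → Normalised b → Normalised (a *ᴰ b)
  *ᴰ-normalised a₁≈1 b₁≈1 =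
    ≈ᶜ-trans (+ᶜ-identityʳ _) (≈ᶜ-trans (*ᶜ-cong a₁≈1 b₁≈1) (*ᶜ-identityˡ 1ᶜ))

  -- Only the divisors 1 and p contribute, giving a 1 · b p and a p · b 1. Of the p = m + 2 summands
  -- these are the ones at indices 0 and m + 1.
  *ᴰ-prime : ∀ {a b p} → Normalised a → Normalised b → Prime p → (a *ᴰ b) p ≈ᶜ a p +ᶜ b p
  *ᴰ-prime {p = 0} _ _ p-prime with () ← prime⇒nonTrivial p-prime
  *ᴰ-prime {p = 1} _ _ p-prime with () ← prime⇒nonTrivial p-prime
  *ᴰ-prime {a} {b} {p@(suc (suc m))} a₁≈1 b₁≈1 p-prime =
    ≈ᶜ-trans (+ᶜ-cong first (≈ᶜ-trans (∑-last m (h ∘ suc) middle) last)) (+ᶜ-comm _ _)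
    where
    h : ℕ → ℂ
    h i = if does (suc i ∣? p) then a (suc i) *ᶜ b (p / suc i) else 0ᶜ

    divisor : ∀ i → suc i ∣ p → h i ≡ a (suc i) *ᶜ b (p / suc i)
    divisor i d∣p = ≡.cong (if_then a (suc i) *ᶜ b (p / suc i) else 0ᶜ) (dec-true (suc i ∣? p) d∣p)

    first : h 0 ≈ᶜ b p
    first = ≈ᶜ-trans (≈ᶜ-reflexive (divisor 0 (1∣ p)))
      (≈ᶜ-trans (*ᶜ-cong a₁≈1 (≈ᶜ-reflexive (≡.cong b (n/1≡n p)))) (*ᶜ-identityˡ (b p)))

    last : h (suc m) ≈ᶜ a p
    last = ≈ᶜ-trans (≈ᶜ-reflexive (divisor (suc m) ∣-refl))
      (≈ᶜ-trans (*ᶜ-cong (≈ᶜ-refl {a p}) (≈ᶜ-trans (≈ᶜ-reflexive (≡.cong b (n/n≡1 p))) b₁≈1)) (*ᶜ-identityʳ (a p)))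

    nonDivisor : ∀ i → i ℕ.< m → ¬ suc (suc i) ∣ p
    -- The alternative that the divisor `suc (suc i)` is 1 is dismissed by unification.
    nonDivisor i i<m d∣p with prime⇒irreducible p-prime d∣p
    ... | inj₂ d≡p = ℕ.<⇒≢ i<m (ℕ.suc-injective (ℕ.suc-injective d≡p))

    middle : ∀ i → i ℕ.< m → h (suc i) ≈ᶜ 0ᶜ
    middle i i<m = ≈ᶜ-reflexive
      (≡.cong (if_then a (suc (suc i)) *ᶜ b (p / suc (suc i)) else 0ᶜ) (dec-false (suc (suc i) ∣? p) (nonDivisor i i<m)))

  1ᴰ-prime : ∀ {p} → Prime p → 1ᴰ p ≈ᶜ 0ᶜ
  1ᴰ-prime {0} _ = ≈ᶜ-refl
  1ᴰ-prime {1} p-prime with () ← prime⇒nonTrivial p-prime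
  1ᴰ-prime {suc (suc _)} _ = ≈ᶜ-refl

  ^ᴰ-normalised : ∀ {a} → Normalised a → ∀ n → Normalised (a ^ᴰ n)
  ^ᴰ-normalised     a₁≈1 zero    = ≈ᶜ-refl
  ^ᴰ-normalised {a} a₁≈1 (suc n) = *ᴰ-normalised {a} {a ^ᴰ n} a₁≈1 (^ᴰ-normalised {a} a₁≈1 n)

  ^ᴰ-prime : ∀ {a p} → Normalised a → Prime p → ∀ n → (a ^ᴰ n) p ≈ᶜ n ×ᶜ a p
  ^ᴰ-prime a₁≈1 p-prime zero = 1ᴰ-prime p-prime
  ^ᴰ-prime {a} {p} a₁≈1 p-prime (suc n) = ≈ᶜ-trans
    (*ᴰ-prime {a} {a ^ᴰ n} {p} a₁≈1 (^ᴰ-normalised {a} a₁≈1 n) p-prime)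
    (+ᶜ-cong ≈ᶜ-refl (^ᴰ-prime {a} {p} a₁≈1 p-prime n))

  ∏ᴰ-normalised : ∀ {k} (as : Fin k → DirichletSeries) → (∀ i → Normalised (as i)) → Normalised (∏ᴰ as)
  ∏ᴰ-normalised {zero}  as norm = ≈ᶜ-refl
  ∏ᴰ-normalised {suc k} as norm =
    *ᴰ-normalised {as zero} {∏ᴰ (as ∘ suc)} (norm zero) (∏ᴰ-normalised (as ∘ suc) (norm ∘ suc))

  ∏ᴰ-prime : ∀ {k p} (as : Fin k → DirichletSeries) → (∀ i → Normalised (as i)) → Prime p →
    ∏ᴰ as p ≈ᶜ ∑ λ i → as i p
  ∏ᴰ-prime {zero}  as norm p-prime = 1ᴰ-prime p-prime
  ∏ᴰ-prime {suc k} {p} as norm p-prime = ≈ᶜ-trans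
    (*ᴰ-prime {as zero} {∏ᴰ (as ∘ suc)} {p} (norm zero) (∏ᴰ-normalised (as ∘ suc) (norm ∘ suc)) p-prime)
    (+ᶜ-cong ≈ᶜ-refl (∏ᴰ-prime (as ∘ suc) (norm ∘ suc) p-prime))

  ∑-cong : ∀ {k} {f g : Fin k → ℂ} → (∀ i → f i ≈ᶜ g i) → ∑ f ≈ᶜ ∑ g
  ∑-cong {zero}  f≈g = ≈ᶜ-refl
  ∑-cong {suc k} f≈g = +ᶜ-cong (f≈g zero) (∑-cong (f≈g ∘ suc))

  ∏ᴰ-^ᴰ-prime : ∀ {k p} (as : Fin k → DirichletSeries) (e : Fin k → ℕ) → (∀ i → Normalised (as i)) → Prime p →
    ∏ᴰ (λ i → as i ^ᴰ e i) p ≈ᶜ ∑ λ i → e i ×ᶜ as i p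
  ∏ᴰ-^ᴰ-prime {p = p} as e norm p-prime = ≈ᶜ-trans
    (∏ᴰ-prime (λ i → as i ^ᴰ e i) (λ i → ^ᴰ-normalised {as i} (norm i) (e i)) p-prime)
    (∑-cong λ i → ^ᴰ-prime {as i} {p} (norm i) p-prime (e i))

-- The pairing of Dirichlet series over primes

module Orthonormality (em : ExcludedMiddle 0ℓ) (real : CompleteOrderedField) where
  open Selberg em real
  open CompleteOrderedField real using (_⁻¹)
  open OrderedField em real
  open Boundedness em real
  open Asymptotics em real (λ x → log (log x))
  open PrimeCoefficients em real
  open Logarithm em real using (loglog-exp-exp; x≤exp)

  Re-∑ₚ≤-cong : ∀ {f g} → (∀ p → Prime p → Re (f p) ≈ Re (g p)) → ∀ x → Re (∑ₚ≤ x f) ≈ Re (∑ₚ≤ x g)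
  Re-∑ₚ≤-cong {f} {g} f≈g x = go (all-filter prime? (upTo (suc ⌊ x ⌋)))
    where
    go : ∀ {ps} → All Prime ps → Re (foldr _+ᶜ_ 0ᶜ (map f ps)) ≈ Re (foldr _+ᶜ_ 0ᶜ (map g ps))
    go []                  = refl
    go (_∷_ {p} p-prime ps-prime) = +-cong (f≈g p p-prime) (go ps-prime)

  Re-∑ₚ≤-0 : ∀ x → Re (∑ₚ≤ x λ _ → 0ᶜ) ≈ 0#
  Re-∑ₚ≤-0 x = go (filter prime? (upTo (suc ⌊ x ⌋)))
    where
    go : ∀ ps → Re (foldr _+ᶜ_ 0ᶜ (map (λ _ → 0ᶜ) ps)) ≈ 0#
    go []       = refl
    go (p ∷ ps) = trans (+-identityˡ _) (go ps)

  Re-∑ₚ≤-+ : ∀ f g x → Re (∑ₚ≤ x λ p → f p +ᶜ g p) ≈ Re (∑ₚ≤ x f) + Re (∑ₚ≤ x g)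
  Re-∑ₚ≤-+ f g x = go (filter prime? (upTo (suc ⌊ x ⌋)))
    where
    go : ∀ ps → Re (foldr _+ᶜ_ 0ᶜ (map (λ p → f p +ᶜ g p) ps)) ≈
                Re (foldr _+ᶜ_ 0ᶜ (map f ps)) + Re (foldr _+ᶜ_ 0ᶜ (map g ps))
    go []       = sym (+-identityˡ 0#)
    go (p ∷ ps) = trans (+-congˡ (go ps))
      (solve 4 (λ a b s t → (a :+ b) :+ (s :+ t) := (a :+ s) :+ (b :+ t)) refl (Re (f p)) (Re (g p))
        (Re (foldr _+ᶜ_ 0ᶜ (map f ps))) (Re (foldr _+ᶜ_ 0ᶜ (map g ps))))

  -- Re (z * conj w)
  dot : ℂ → ℂ → ℝ
  dot z w = Re z * Re w + Im z * Im w

  -- ∑_{p≤x} Re (a_p conj b_p) / p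
  ⟨_,_⟩ : DirichletSeries → DirichletSeries → ℝ → ℝ
  ⟨ a , b ⟩ x = Re (∑ₚ≤ x λ p → ofℝ (dot (a p) (b p) * fromℕ p ⁻¹))

  -- Symmetry is what passing to real parts buys: additivity in the left argument alone then gives
  -- the full bilinear expansion.
  ⟨⟩-comm : ∀ a b x → ⟨ a , b ⟩ x ≈ ⟨ b , a ⟩ x
  ⟨⟩-comm a b = Re-∑ₚ≤-cong λ p _ → *-congʳ (+-cong (*-comm _ _) (*-comm _ _))

  ⟨⟩-congˡ : ∀ {a a′} b → (∀ p → Prime p → a p ≈ᶜ a′ p) → ∀ x → ⟨ a , b ⟩ x ≈ ⟨ a′ , b ⟩ x
  ⟨⟩-congˡ b a≈a′ = Re-∑ₚ≤-cong λ p p-prime →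
    *-congʳ (+-cong (*-congʳ (proj₁ (a≈a′ p p-prime))) (*-congʳ (proj₂ (a≈a′ p p-prime))))

  ⟨0⟩ : ∀ b x → ⟨ (λ _ → 0ᶜ) , b ⟩ x ≈ 0#
  ⟨0⟩ b x = trans
    (Re-∑ₚ≤-cong (λ p _ → solve 3 (λ r i q → (con (+ 0) :* r :+ con (+ 0) :* i) :* q := con (+ 0)) refl (Re (b p)) (Im (b p)) (fromℕ p ⁻¹)) x)
    (Re-∑ₚ≤-0 x)

  ⟨+⟩ : ∀ a a′ b x → ⟨ (λ n → a n +ᶜ a′ n) , b ⟩ x ≈ ⟨ a , b ⟩ x + ⟨ a′ , b ⟩ x
  ⟨+⟩ a a′ b x = trans
    (Re-∑ₚ≤-cong {g = λ p → ofℝ (dot (a p) (b p) * fromℕ p ⁻¹) +ᶜ ofℝ (dot (a′ p) (b p) * fromℕ p ⁻¹)} (λ p _ → solve 7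
      (λ r i s j u v q → ((r :+ s) :* u :+ (i :+ j) :* v) :* q := (r :* u :+ i :* v) :* q :+ (s :* u :+ j :* v) :* q)
      refl (Re (a p)) (Im (a p)) (Re (a′ p)) (Im (a′ p)) (Re (b p)) (Im (b p)) (fromℕ p ⁻¹)) x)
    (Re-∑ₚ≤-+ _ _ x)

  ⟨×⟩-∼ : ∀ {a b c} m → ⟨ a , b ⟩ ∼ fromℕ c → ⟨ (λ n → m ×ᶜ a n) , b ⟩ ∼ fromℕ (m ℕ.* c)
  ⟨×⟩-∼ {a} {b} zero    _ = ∼-cong (λ x → sym (⟨0⟩ b x)) refl ∼-0
  ⟨×⟩-∼ {a} {b} {c} (suc m) a∼c = ∼-cong (λ x → sym (⟨+⟩ a (λ n → m ×ᶜ a n) b x)) (sym (fromℕ-+ c (m ℕ.* c)))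
    (∼-+ a∼c (⟨×⟩-∼ {a} {b} {c} m a∼c))

  ⟨∑⟩-∼ : ∀ {k} (as : Fin k → DirichletSeries) (e c : Fin k → ℕ) b → (∀ i → ⟨ as i , b ⟩ ∼ fromℕ (c i)) →
    ⟨ (λ n → ∑ λ i → e i ×ᶜ as i n) , b ⟩ ∼ fromℕ (sum λ i → e i ℕ.* c i)
  ⟨∑⟩-∼ {zero}  as e c b _ = ∼-cong (λ x → sym (⟨0⟩ b x)) refl ∼-0
  ⟨∑⟩-∼ {suc k} as e c b as∼c = ∼-cong
    (λ x → sym (⟨+⟩ (λ n → e zero ×ᶜ as zero n) (λ n → ∑ λ i → e (suc i) ×ᶜ as (suc i) n) b x))
    (sym (fromℕ-+ (e zero ℕ.* c zero) (sum λ i → e (suc i) ℕ.* c (suc i))))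
    (∼-+ (⟨×⟩-∼ {as zero} {b} {c zero} (e zero) (as∼c zero)) (⟨∑⟩-∼ (as ∘ suc) (e ∘ suc) (c ∘ suc) b (as∼c ∘ suc)))

  -- `pairing` is applied twice. Against `Fs i`, orthonormality collapses the sum to e i; with the
  -- arguments swapped, these values are the coefficients for pairing against F itself, which gives
  -- the sum of e i · e i.
  product-∼ : ∀ {k F} (Fs : Fin k → DirichletSeries) (e : Fin k → ℕ) → (∀ i → Normalised (Fs i)) →
    (∀ i j → ⟨ Fs i , Fs j ⟩ ∼ fromℕ (kronecker i j)) →
    F ≈ᴰ ∏ᴰ (λ i → Fs i ^ᴰ e i) → ⟨ F , F ⟩ ∼ fromℕ (sum λ i → e i ℕ.^ 2)
  product-∼ {k} {F} Fs e normalised orthonormal F≈∏ = ∼-cong (λ _ → refl)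
    -- `e i ^ 2` unfolds to `e i * (e i * 1)`, so the trailing factor 1 has to be matched.
    (reflexive (≡.cong fromℕ (sum-cong-≗ λ i → ≡.cong (e i ℕ.*_) (≡.sym (ℕ.*-identityʳ (e i))))))
    (pairing F e factor-∼)
    where
    combination : DirichletSeries
    combination n = ∑ λ i → e i ×ᶜ Fs i n

    F≈combination : ∀ p → Prime p → F p ≈ᶜ combination p
    F≈combination p p-prime =
      ≈ᶜ-trans (F≈∏ p (ℕ.>-nonZero⁻¹ p {{prime⇒nonZero p-prime}})) (∏ᴰ-^ᴰ-prime Fs e normalised p-prime)

    pairing : ∀ b c → (∀ i → ⟨ Fs i , b ⟩ ∼ fromℕ (c i)) → ⟨ F , b ⟩ ∼ fromℕ (sum λ i → e i ℕ.* c i)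
    pairing b c Fs∼c = ∼-cong (λ x → sym (⟨⟩-congˡ {F} {combination} b F≈combination x)) refl (⟨∑⟩-∼ Fs e c b Fs∼c)

    factor-∼ : ∀ i → ⟨ Fs i , F ⟩ ∼ fromℕ (e i)
    factor-∼ i = ∼-cong (⟨⟩-comm F (Fs i)) (reflexive (≡.cong fromℕ (sum-kronecker e i)))
      (pairing (Fs i) (λ j → kronecker j i) λ j → orthonormal j i)

  loglog-unbounded : Unbounded
  loglog-unbounded M 0<M = exp (exp M) ,
    ≤-trans (x≤exp (<⇒≤ 0<M)) (x≤exp (≤-trans (<⇒≤ 0<M) (x≤exp (<⇒≤ 0<M)))) , loglog-exp-exp 0<M

  -- This is the real part of (A): `dot z z` unfolds to `∣ z ∣²`, and `Re` of a complex difference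
  -- unfolds to a real one.
  self-∼ : ∀ (A : ConjectureA) {a} (a∈𝒮 : 𝒮 a) → ⟨ a , a ⟩ ∼ fromℤ (n[ A ] a a∈𝒮)
  self-∼ A {a} a∈𝒮 = IsO1⇒Bounded-Re (proj₂ (A a a∈𝒮))

  primitive-∼ : ∀ A → ConjectureB A → ∀ {a} → Primitive a → ⟨ a , a ⟩ ∼ fromℕ 1
  primitive-∼ A B {a} a-prim =
    ∼-cong {⟨ a , a ⟩} (λ _ → refl) (reflexive (≡.cong fromℤ (proj₁ B a a-prim))) (self-∼ A {a} (proj₁ a-prim))

  -- (B) states its bound with complex products and a conjugate. Their real part expands to `dot`,
  -- and the term 0 · log log x is added to fit the form of `∼`.
  distinct-∼ : ∀ A → ConjectureB A → ∀ {a b} → Primitive a → Primitive b → a ≉ᴰ b → ⟨ a , b ⟩ ∼ fromℕ 0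
  distinct-∼ A B {a} {b} a-prim b-prim a≉b = Bounded-cong
    (λ x → trans
      (Re-∑ₚ≤-cong {g = λ p → ofℝ (dot (a p) (b p) * fromℕ p ⁻¹)}
        (λ p _ → solve 5 (λ r i s j q → (r :* s :- i :* (:- j)) :* q :- (r :* (:- j) :+ i :* s) :* con (+ 0) := (r :* s :+ i :* j) :* q)
          refl (Re (a p)) (Im (a p)) (Re (b p)) (Im (b p)) (fromℕ p ⁻¹)) x)
      (solve 2 (λ s l → s := s :- con (+ 0) :* l) refl (⟨ a , b ⟩ x) (log (log x))))
    (IsO1⇒Bounded-Re (proj₂ B a b a-prim b-prim a≉b))

  primitive-normalised : ∀ {a} → Primitive a → Normalised a
  primitive-normalised a-prim = proj₁ (proj₂ (proj₂ (proj₁ a-prim)))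

  n≡∑e² : ∀ A → ConjectureB A → ∀ {k F} (F∈𝒮 : 𝒮 F) (Fs : Fin k → DirichletSeries) (e : Fin k → ℕ) →
    (∀ i → Primitive (Fs i)) → (∀ i j → i ≢ j → Fs i ≉ᴰ Fs j) →
    F ≈ᴰ ∏ᴰ (λ i → Fs i ^ᴰ e i) → n[ A ] F F∈𝒮 ≡ + sum (λ i → e i ℕ.^ 2)
  n≡∑e² A B {F = F} F∈𝒮 Fs e Fs-prim distinct F≈∏ =
    ∼-unique loglog-unbounded {⟨ F , F ⟩} (n[ A ] F F∈𝒮) (sum λ i → e i ℕ.^ 2) (self-∼ A {F} F∈𝒮)
      (product-∼ {F = F} Fs e (λ i → primitive-normalised {Fs i} (Fs-prim i))
        (kronecker-∼ (λ i j → ⟨ Fs i , Fs j ⟩) (λ i → primitive-∼ A B {Fs i} (Fs-prim i))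
          (λ i j i≢j → distinct-∼ A B {Fs i} {Fs j} (Fs-prim i) (Fs-prim j) (distinct i j i≢j)))
        F≈∏)

open import Data.Nat.Base using (_<_; _^_)

proposition4p1 : (em : ExcludedMiddle 0ℓ) (real : CompleteOrderedField) →
    let open Selberg em real in
    (A : ConjectureA) → ConjectureB A → ConjectureC →
    ∀ F (F∈𝒮 : 𝒮 F) (k : ℕ) (Fs : Fin k → DirichletSeries) (e : Fin k → ℕ) →
    (∀ i → Primitive (Fs i)) →
    (∀ i j → i ≢ j → Fs i ≉ᴰ Fs j) →
    (∀ i → 0 < e i) →
    F ≈ᴰ ∏ᴰ (λ i → Fs i ^ᴰ e i) →
    n[ A ] F F∈𝒮 ≡ + sum (λ i → e i ^ 2)
proposition4p1 em real = λ A B _ F F∈𝒮 k Fs e Fs-prim distinct _ F≈∏ →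
  n≡∑e² A B {k} {F} F∈𝒮 Fs e Fs-prim distinct F≈∏
  where open Orthonormality em real
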